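{- Let $G$ be a simple connected graph of minimum degree at least $4$ and let $x$ be a vertex of $G$. Then $G$ contains an induced subgraph $H$ isomorphic to a subdivision of a wheel, or of the prism $K_2 \times K_3$, or of $K_{3,3}$, such that $G-V(H)$ is connected and contains $x$.
   Context: The wheel $W_\ell$ ($\ell \ge 3$) is obtained from a cycle of length $\ell$ by adding a new vertex adjacent to all vertices of the cycle; in particular $W_3 \cong K_4$. A subdivision of a graph $P$ is obtained by replacing edges of $P$ by internally disjoint paths. $K_2 \times K_3$ is the prism (two disjoint triangles joined by a perfect matching). -}

module Defs where

open import Data.Nat using (ℕ; zero; suc; _+_; _≤_; _<ᵇ_; _≡ᵇ_)
open import Data.Bool using (Bool; true; false; _∧_; _∨_; not; _xor_)
open import Data.Fin using (Fin; zero; suc; toℕ)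
open import Data.Fin.Subset using (Subset; _∈_; _∉_; ⊤; ∁) public
open import Data.List using (length; filterᵇ; allFin)
open import Data.Product using (Σ; ∃; _×_)
open import Function.Definitions using (Injective)
open import Relation.Binary.PropositionalEquality using (_≡_)

Adj : ℕ → Set
Adj n = Fin n → Fin n → Bool

_=ᶠ_ : ∀ {n} → Fin n → Fin n → Bool
i =ᶠ j = toℕ i ≡ᵇ toℕ j

record SimpleGraph : Set where
  field
    n      : ℕ
    adj    : Adj n
    sym    : ∀ i j → adj i j ≡ adj j i
    irrefl : ∀ i → adj i i ≡ false
open SimpleGraph public

degree : (G : SimpleGraph) → Fin (n G) → ℕ
degree G v = length (filterᵇ (adj G v) (allFin (n G)))

MinDegreeAtLeast : ℕ → SimpleGraph → Set
MinDegreeAtLeast k G = ∀ v → k ≤ degree G v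

-- Walks in G using only vertices of S (all vertices after the first lie in S;
-- the first lies in S by the hypotheses of ConnectedOn).
data WalkIn (G : SimpleGraph) (S : Subset (n G)) : Fin (n G) → Fin (n G) → Set where
  here : ∀ {v} → WalkIn G S v v
  step : ∀ {u w v} → adj G u w ≡ true → w ∈ S → WalkIn G S w v → WalkIn G S u v

ConnectedOn : (G : SimpleGraph) → Subset (n G) → Set
ConnectedOn G S = ∀ u v → u ∈ S → v ∈ S → WalkIn G S u v

-- G is connected (G has at least one vertex in our use, via the vertex x)
Connected : SimpleGraph → Set
Connected G = ∀ u v → WalkIn G ⊤ u v


-- Subdividing the edge {u,v} of a graph on Fin m: new vertex is `zero`,
-- old vertex i becomes `suc i`; edge uv is removed, new vertex joined to u and v.
subdivide : ∀ {m} → Adj m → Fin m → Fin m → Adj (suc m)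
subdivide A u v zero    zero    = false
subdivide A u v zero    (suc j) = (j =ᶠ u) ∨ (j =ᶠ v)
subdivide A u v (suc i) zero    = (i =ᶠ u) ∨ (i =ᶠ v)
subdivide A u v (suc i) (suc j) =
  A i j ∧ not (((i =ᶠ u) ∧ (j =ᶠ v)) ∨ ((i =ᶠ v) ∧ (j =ᶠ u)))

-- Subdivision A k B : the graph (Fin k, B) is a subdivision of (Fin m, A),
-- i.e. obtained by repeatedly subdividing edges (= replacing edges by
-- internally disjoint paths).
data Subdivision {m : ℕ} (A : Adj m) : (k : ℕ) → Adj k → Set where
  base : Subdivision A m A
  sub  : ∀ {k B} (u v : Fin k) → B u v ≡ true →
         Subdivision A k B → Subdivision A (suc k) (subdivide B u v)

-- Wheel W_ℓ on Fin (suc ℓ): hub = zero, rim vertices suc i (i : Fin ℓ)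
-- forming the cycle 0 - 1 - ... - (ℓ-1) - 0.
wheel : (ℓ : ℕ) → Adj (suc ℓ)
wheel ℓ zero    zero    = false
wheel ℓ zero    (suc j) = true
wheel ℓ (suc i) zero    = true
wheel ℓ (suc i) (suc j) =
  (suc (toℕ i) ≡ᵇ toℕ j) ∨ (suc (toℕ j) ≡ᵇ toℕ i)
  ∨ ((toℕ i ≡ᵇ 0) ∧ (suc (toℕ j) ≡ᵇ ℓ))
  ∨ ((toℕ j ≡ᵇ 0) ∧ (suc (toℕ i) ≡ᵇ ℓ))

-- Prism K₂ × K₃: triangles {0,1,2}, {3,4,5}, matching i — i+3.
prism : Adj 6
prism i j =
  ((toℕ i <ᵇ 3) ∧ (toℕ j <ᵇ 3) ∧ not (i =ᶠ j))
  ∨ (not (toℕ i <ᵇ 3) ∧ not (toℕ j <ᵇ 3) ∧ not (i =ᶠ j))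
  ∨ (toℕ i + 3 ≡ᵇ toℕ j) ∨ (toℕ j + 3 ≡ᵇ toℕ i)

K33 : Adj 6
K33 i j = (toℕ i <ᵇ 3) xor (toℕ j <ᵇ 3)

InducedIso : (G : SimpleGraph) → Subset (n G) → (k : ℕ) → Adj k → Set
InducedIso G S k B =
  Σ (Fin k → Fin (n G)) λ f →
    Injective _≡_ _≡_ f
    × (∀ v → v ∈ S → ∃ λ i → f i ≡ v)
    × (∀ i → f i ∈ S)
    × (∀ i j → adj G (f i) (f j) ≡ B i j)

IsoToSubdivisionOf : (G : SimpleGraph) → Subset (n G) → (m : ℕ) → Adj m → Set
IsoToSubdivisionOf G S m A =
  Σ ℕ λ k → Σ (Adj k) λ B → Subdivision A k B × InducedIso G S k B

{-# OPTIONS --safe #-}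
module Submission where

-- Delete x and let N be the set of neighbours of x in S = G − x, so that all
-- degrees in S are at least 3, and at least 4 outside N. We look for a member K
-- of the family, induced in S, such that every vertex of S − K can still reach N.
-- By induction on |S|, allowing up to two adjacent "exempt" vertices of smaller
-- degree in N: deleting a vertex of N and putting its neighbours into N preserves
-- the situation as long as the vertices that become too small can be exempted,
-- and an exempt vertex of degree at most 2 is deleted or suppressed (suppression
-- lifts to a subdivision). Hence every vertex of degree 3 has two nonadjacent
-- neighbours of degree 3, unless it lies in a component K₄. An edge ab between
-- vertices of degree 3 that is in no triangle is contracted; a solution lifts
-- by subdividing an edge, except that the contracted vertex may be the hub of a
-- subdivided W₄, which splits into a subdivided prism or K₃₃. If all these edges
-- lie in triangles, the vertices of degree 3 around a common neighbour c form a
-- wheel with hub c; either the wheel is all of S, or its rim is deleted and c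
-- becomes exempt.

open import Defs
open import Data.Bool using (Bool; true; false; T; _∧_; _∨_; not) renaming (_≟_ to _≟ᵇ_)
open import Data.Bool.Properties using (∧-zeroʳ; ∧-identityʳ; ∧-comm; ∨-comm; ∨-identityʳ)
open import Data.Empty using (⊥; ⊥-elim)
open import Data.Fin using (Fin; zero; suc; toℕ; fromℕ<)
open import Data.Fin.Patterns using (0F; 1F; 2F; 3F; 4F; 5F)
open import Data.Fin.Properties using (_≟_; toℕ-injective; toℕ<n; toℕ-fromℕ<; all?; any?; pigeonhole)
open import Data.Fin.Properties using () renaming (suc-injective to sucᶠ-injective)
open import Data.Fin.Subset using (Subset; _∈_; _∉_)
open import Data.Fin.Subset.Properties using (x∈∁p⇒x∉p; x∉p⇒x∈∁p)
open import Data.List using (length; filterᵇ; tabulate)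
open import Data.Nat using (ℕ; zero; suc; _+_; _≤_; _<_; z≤n; s≤s; _≡ᵇ_; _≤?_) renaming (_≟_ to _≟ⁿ_)
open import Data.Nat.Properties using (≡ᵇ⇒≡; ≡⇒≡ᵇ; ≤-refl; ≤-trans; ≤-reflexive; n≤1+n; +-mono-≤; +-suc; suc-injective; 0≢1+n)
open import Data.Nat.Properties using (<-irrefl; <-trans; n<1+n; ≰⇒>; m≤n⇒m<n∨m≡n; ≤∧≢⇒<)
open import Data.Product using (Σ; ∃; _×_; _,_; proj₁; proj₂)
open import Data.Sum using (_⊎_; inj₁; inj₂) renaming (swap to ⊎-swap)
open import Data.Vec using ([]; _∷_; lookup) renaming (tabulate to tabulateᵛ)
open import Data.Vec.Properties using (lookup∘tabulate; lookup⇒[]=; []=⇒lookup)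
open import Function using (_∘_; id)
open import Function.Definitions using (Injective)
open import Relation.Binary.PropositionalEquality using (_≡_; _≢_; refl; cong; cong₂; trans; subst) renaming (sym to ≡-sym)
open import Relation.Nullary using (¬_; Dec; yes; no)
open import Relation.Nullary.Decidable using (True; toWitness; ⌊_⌋; ¬?; _×-dec_; _→-dec_; decidable-stable)

-- Booleans

-- The bound four is spent as follows. A vertex loses degree through a deletion only while it enters
-- `N`, so every vertex of degree three lies in `N`. If such a vertex stays outside `K` it is an
-- exit by itself, and therefore surgery on vertices of degree three hardly endangers reachability.
-- What a deletion can spoil is the degree bound at neighbours of degree three; hence the
-- exemptions. Adjacency of the two exempt vertices keeps their number at two: when one of them, of
-- degree at most two, is deleted, the vertices that newly need exemption are among its neighbours,
-- and the other exempt vertex is one of these. Two neighbours that are not adjacent cannot be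
-- exempted together, and this is what makes suppression necessary.

true≢false : ∀ {b} → b ≡ true → b ≡ false → ⊥
true≢false refl ()

bool : (b : Bool) → (b ≡ true) ⊎ (b ≡ false)
bool true  = inj₁ refl
bool false = inj₂ refl

¬true⇒false : ∀ {b} → ¬ (b ≡ true) → b ≡ false
¬true⇒false {true}  h = ⊥-elim (h refl)
¬true⇒false {false} h = refl

bool-ext : ∀ {a b} → (a ≡ true → b ≡ true) → (b ≡ true → a ≡ true) → a ≡ b
bool-ext {true}  {b}     f g = ≡-sym (f refl)
bool-ext {false} {true}  f g = g refl
bool-ext {false} {false} f g = refl

∧-intro : ∀ {a b} → a ≡ true → b ≡ true → a ∧ b ≡ true
∧-intro refl refl = refl

∧-elim : ∀ {a b} → a ∧ b ≡ true → (a ≡ true) × (b ≡ true)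
∧-elim {true} {true} refl = refl , refl

∨-introˡ : ∀ {a b} → a ≡ true → a ∨ b ≡ true
∨-introˡ refl = refl

∨-introʳ : ∀ {a b} → b ≡ true → a ∨ b ≡ true
∨-introʳ {true}  refl = refl
∨-introʳ {false} refl = refl

∨-elim : ∀ {a b} → a ∨ b ≡ true → (a ≡ true) ⊎ (b ≡ true)
∨-elim {true}  h = inj₁ refl
∨-elim {false} h = inj₂ h

not-true : ∀ {a} → not a ≡ true → a ≡ false
not-true {false} refl = refl

not-false : ∀ {a} → ¬ (a ≡ true) → not a ≡ true
not-false {true}  h = ⊥-elim (h refl)
not-false {false} h = refl

T→≡ : ∀ {b} → T b → b ≡ true
T→≡ {true} _ = refl

≡→T : ∀ {b} → b ≡ true → T b
≡→T refl = _

≡ᵇ-true : ∀ {i j} → (i ≡ᵇ j) ≡ true → i ≡ j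
≡ᵇ-true {i} {j} h = ≡ᵇ⇒≡ i j (≡→T h)

≡ᵇ-intro : ∀ {i j} → i ≡ j → (i ≡ᵇ j) ≡ true
≡ᵇ-intro {i} {j} h = T→≡ (≡⇒≡ᵇ i j h)

=ᶠ⇒≡ : ∀ {n} {i j : Fin n} → (i =ᶠ j) ≡ true → i ≡ j
=ᶠ⇒≡ h = toℕ-injective (≡ᵇ-true h)

≡⇒=ᶠ : ∀ {n} {i j : Fin n} → i ≡ j → (i =ᶠ j) ≡ true
≡⇒=ᶠ {i = i} refl = ≡ᵇ-intro {toℕ i} refl

≢⇒=ᶠ : ∀ {n} {i j : Fin n} → i ≢ j → (i =ᶠ j) ≡ false
≢⇒=ᶠ h = ¬true⇒false (λ e → h (=ᶠ⇒≡ e))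

=ᶠ-injective : ∀ {m n} {f : Fin m → Fin n} → Injective _≡_ _≡_ f →
  ∀ i j → (f i =ᶠ f j) ≡ (i =ᶠ j)
=ᶠ-injective {f = f} inj i j =
  bool-ext (λ h → ≡⇒=ᶠ (inj (=ᶠ⇒≡ h))) (λ h → ≡⇒=ᶠ (cong f (=ᶠ⇒≡ h)))

-- Vertex sets and counting

VSet : ℕ → Set
VSet n = Fin n → Bool

infix 4 _∋_ _∌_
_∋_ : ∀ {n} → VSet n → Fin n → Set
p ∋ x = p x ≡ true

_∌_ : ∀ {n} → VSet n → Fin n → Set
p ∌ x = p x ≡ false

infixl 6 _∖_ _⊕_
_∖_ : ∀ {n} → VSet n → Fin n → VSet n
(p ∖ v) x = p x ∧ not (x =ᶠ v)

_⊕_ : ∀ {n} → VSet n → Fin n → VSet n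
(p ⊕ v) x = p x ∨ (x =ᶠ v)

∖-intro : ∀ {n} {p : VSet n} {v x} → p ∋ x → x ≢ v → p ∖ v ∋ x
∖-intro h ne = ∧-intro h (not-false (λ e → ne (=ᶠ⇒≡ e)))

∖-elim : ∀ {n} {p : VSet n} {v x} → p ∖ v ∋ x → (p ∋ x) × (x ≢ v)
∖-elim h with ∧-elim h
... | a , b = a , λ e → true≢false (≡⇒=ᶠ e) (not-true b)

∖-self : ∀ {n} (p : VSet n) v → p ∖ v ∌ v
∖-self p v = ¬true⇒false (λ h → proj₂ (∖-elim {p = p} h) refl)

∖-out : ∀ {n} {p : VSet n} {v x} → p ∋ x → p ∖ v ∌ x → x ≡ v
∖-out {p = p} {v} {x} h k with x ≟ v
... | yes e = e
... | no ne = ⊥-elim (true≢false (∖-intro {p = p} h ne) k)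

⊕-elim : ∀ {n} {p : VSet n} {v x} → p ⊕ v ∋ x → (p ∋ x) ⊎ (x ≡ v)
⊕-elim h with ∨-elim h
... | inj₁ a = inj₁ a
... | inj₂ b = inj₂ (=ᶠ⇒≡ b)

⊕-old : ∀ {n} {p : VSet n} {v x} → p ∋ x → p ⊕ v ∋ x
⊕-old h = ∨-introˡ h

⊕-new : ∀ {n} (p : VSet n) v → p ⊕ v ∋ v
⊕-new p v = ∨-introʳ {p v} (≡⇒=ᶠ {i = v} refl)

⊕-out : ∀ {n} {p : VSet n} {v x} → p ⊕ v ∌ x → (p ∌ x) × (x ≢ v)
⊕-out {p = p} {v} {x} h =
  ¬true⇒false (λ e → true≢false (⊕-old {p = p} e) h) ,
  λ { refl → true≢false (⊕-new p v) h }

bit : Bool → ℕ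
bit true  = 1
bit false = 0

count : ∀ {n} → VSet n → ℕ
count {zero}  p = 0
count {suc n} p = bit (p zero) + count (p ∘ suc)

count-cong : ∀ {n} {p q : VSet n} → (∀ x → p x ≡ q x) → count p ≡ count q
count-cong {zero}  h = refl
count-cong {suc n} h = cong₂ _+_ (cong bit (h zero)) (count-cong (h ∘ suc))

bit-mono : ∀ {a b} → (a ≡ true → b ≡ true) → bit a ≤ bit b
bit-mono {false}         h = z≤n
bit-mono {true}  {true}  h = ≤-refl
bit-mono {true}  {false} h with h refl
... | ()

count-mono : ∀ {n} {p q : VSet n} → (∀ x → p ∋ x → q ∋ x) → count p ≤ count q
count-mono {zero}  h = z≤n
count-mono {suc n} h = +-mono-≤ (bit-mono (h zero)) (count-mono (h ∘ suc))

count-remove : ∀ {n} {p : VSet n} {v} → p ∋ v → count p ≡ suc (count (p ∖ v))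
count-remove {suc n} {p} {zero}  h rewrite h =
  cong suc (count-cong (λ x → ≡-sym (∧-identityʳ (p (suc x)))))
count-remove {suc n} {p} {suc v} h rewrite ∧-identityʳ (p zero) =
  trans (cong (bit (p zero) +_) (count-remove {p = p ∘ suc} {v} h)) (+-suc (bit (p zero)) _)

count-empty : ∀ {n} {p : VSet n} → (∀ x → p ∌ x) → count p ≡ 0
count-empty {zero}  h = refl
count-empty {suc n} h rewrite h zero = count-empty (h ∘ suc)

count≡0 : ∀ {n} {p : VSet n} → count p ≡ 0 → ∀ x → p ∌ x
count≡0 {p = p} h x = ¬true⇒false λ e → 0≢1+n (trans (≡-sym h) (count-remove {p = p} e))

count>0 : ∀ {n} {p : VSet n} → 1 ≤ count p → ∃ λ v → p ∋ v
count>0 {suc n} {p} h with bool (p zero)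
... | inj₁ e = zero , e
... | inj₂ e rewrite e with count>0 {p = p ∘ suc} h
...   | v , e′ = suc v , e′

count-pick : ∀ {n} {p : VSet n} {k} → count p ≡ suc k → ∃ λ v → (p ∋ v) × (count (p ∖ v) ≡ k)
count-pick {p = p} h with count>0 {p = p} (≤-trans (s≤s z≤n) (≤-reflexive (≡-sym h)))
... | v , e = v , e , suc-injective (trans (≡-sym (count-remove {p = p} e)) h)

count-remove≤ : ∀ {n} (p : VSet n) v → count p ≤ suc (count (p ∖ v))
count-remove≤ p v with bool (p v)
... | inj₁ e = ≤-reflexive (count-remove {p = p} e)
... | inj₂ e = ≤-trans (count-mono {p = p} {p ∖ v}
    λ x e′ → ∖-intro {p = p} e′ λ { refl → true≢false e′ e }) (n≤1+n _)

count-remove≥ : ∀ {n} (p : VSet n) {k} v → suc k ≤ count p → k ≤ count (p ∖ v)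
count-remove≥ p v h with ≤-trans h (count-remove≤ p v)
... | s≤s h′ = h′

count-exchange : ∀ {n} {p q : VSet n} {v w} → p ∋ v → p ∌ w → q ∋ w →
  (∀ x → x ≢ w → q x ≡ (p ∖ v) x) → count q ≡ count p
count-exchange {p = p} {q} {v} {w} pv pw qw h =
  trans (count-remove {p = q} qw)
    (trans (cong suc (count-cong same)) (≡-sym (count-remove {p = p} pv)))
  where
  same : ∀ x → (q ∖ w) x ≡ (p ∖ v) x
  same x with x ≟ w
  ... | yes refl = trans (∖-self q w) (≡-sym (cong (_∧ _) pw))
  ... | no ne rewrite ≢⇒=ᶠ ne | ∧-identityʳ (q x) = h x ne

record Three {n} (p : VSet n) (a b c : Fin n) : Set where
  constructor mkThree
  field
    in₁ : p ∋ a
    in₂ : p ∋ b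
    in₃ : p ∋ c
    a≢b : a ≢ b
    a≢c : a ≢ c
    b≢c : b ≢ c
    all : ∀ {x} → p ∋ x → (x ≡ a) ⊎ (x ≡ b) ⊎ (x ≡ c)

three-rotate : ∀ {n} {p : VSet n} {a b c} → Three p a b c → Three p b c a
three-rotate (mkThree i j k ab ac bc all) =
  mkThree j k i bc (ab ∘ ≡-sym) (ac ∘ ≡-sym) λ e → turn (all e)
  where
  turn : ∀ {X Y Z : Set} → X ⊎ Y ⊎ Z → Y ⊎ Z ⊎ X
  turn (inj₁ x)        = inj₂ (inj₂ x)
  turn (inj₂ (inj₁ y)) = inj₁ y
  turn (inj₂ (inj₂ z)) = inj₂ (inj₁ z)

three-intro : ∀ {n} {p : VSet n} {a b c} → count p ≡ 3 → p ∋ a → p ∋ b → p ∋ c →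
  a ≢ b → a ≢ c → b ≢ c → Three p a b c
three-intro {p = p} {a} {b} {c} h pa pb pc ab ac bc = mkThree pa pb pc ab ac bc all
  where
  h₁ : count (p ∖ a) ≡ 2
  h₁ = suc-injective (trans (≡-sym (count-remove {p = p} pa)) h)
  b∈ : p ∖ a ∋ b
  b∈ = ∖-intro {p = p} pb (ab ∘ ≡-sym)
  h₂ : count (p ∖ a ∖ b) ≡ 1
  h₂ = suc-injective (trans (≡-sym (count-remove {p = p ∖ a} b∈)) h₁)
  c∈ : p ∖ a ∖ b ∋ c
  c∈ = ∖-intro {p = p ∖ a} (∖-intro {p = p} pc (ac ∘ ≡-sym)) (bc ∘ ≡-sym)
  h₃ : count (p ∖ a ∖ b ∖ c) ≡ 0
  h₃ = suc-injective (trans (≡-sym (count-remove {p = p ∖ a ∖ b} c∈)) h₂)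
  all : ∀ {x} → p ∋ x → (x ≡ a) ⊎ (x ≡ b) ⊎ (x ≡ c)
  all {x} px with x ≟ a | x ≟ b | x ≟ c
  ... | yes e | _ | _ = inj₁ e
  ... | no _ | yes e | _ = inj₂ (inj₁ e)
  ... | no _ | no _ | yes e = inj₂ (inj₂ e)
  ... | no na | no nb | no nc = ⊥-elim (true≢false
        (∖-intro {p = p ∖ a ∖ b} (∖-intro {p = p ∖ a} (∖-intro {p = p} px na) nb) nc)
        (count≡0 {p = p ∖ a ∖ b ∖ c} h₃ x))

three-elements : ∀ {n} {p : VSet n} → count p ≡ 3 → ∃ λ a → ∃ λ b → ∃ λ c → Three p a b c
three-elements {p = p} h with count-pick {p = p} h
... | a , pa , h₁ with count-pick {p = p ∖ a} h₁
...   | b , pb , h₂ with count-pick {p = p ∖ a ∖ b} h₂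
...     | c , pc , h₃ with ∖-elim {p = p} pb | ∖-elim {p = p ∖ a} pc
...       | pb′ , ba | pc′ , cb with ∖-elim {p = p} pc′
...         | pc″ , ca = a , b , c ,
              three-intro {p = p} h pa pb′ pc″ (ba ∘ ≡-sym) (ca ∘ ≡-sym) (cb ∘ ≡-sym)

three-third : ∀ {n} {p : VSet n} {a b} → count p ≡ 3 → p ∋ a → p ∋ b → a ≢ b → ∃ λ c → Three p a b c
three-third {p = p} {a} {b} h pa pb ab with three-elements {p = p} h
... | x , y , z , t = pick (Three.all t pa) (Three.all t pb)
  where
  open Three t using (in₁; in₂; in₃; a≢b; a≢c; b≢c)
  pick : (a ≡ x) ⊎ (a ≡ y) ⊎ (a ≡ z) → (b ≡ x) ⊎ (b ≡ y) ⊎ (b ≡ z) → ∃ λ c → Three p a b c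
  pick (inj₁ refl)        (inj₁ refl)        = ⊥-elim (ab refl)
  pick (inj₁ refl)        (inj₂ (inj₁ refl)) = z , three-intro {p = p} h pa pb in₃ ab a≢c b≢c
  pick (inj₁ refl)        (inj₂ (inj₂ refl)) = y , three-intro {p = p} h pa pb in₂ ab a≢b (b≢c ∘ ≡-sym)
  pick (inj₂ (inj₁ refl)) (inj₁ refl)        = z , three-intro {p = p} h pa pb in₃ ab b≢c a≢c
  pick (inj₂ (inj₁ refl)) (inj₂ (inj₁ refl)) = ⊥-elim (ab refl)
  pick (inj₂ (inj₁ refl)) (inj₂ (inj₂ refl)) = x , three-intro {p = p} h pa pb in₁ ab (a≢b ∘ ≡-sym) (a≢c ∘ ≡-sym)
  pick (inj₂ (inj₂ refl)) (inj₁ refl)        = y , three-intro {p = p} h pa pb in₂ ab (b≢c ∘ ≡-sym) a≢b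
  pick (inj₂ (inj₂ refl)) (inj₂ (inj₁ refl)) = x , three-intro {p = p} h pa pb in₁ ab (a≢c ∘ ≡-sym) (a≢b ∘ ≡-sym)
  pick (inj₂ (inj₂ refl)) (inj₂ (inj₂ refl)) = ⊥-elim (ab refl)

length-filter-tabulate : ∀ {m n} (p : VSet n) (f : Fin m → Fin n) →
  length (filterᵇ p (tabulate f)) ≡ count (p ∘ f)
length-filter-tabulate {zero}  p f = refl
length-filter-tabulate {suc m} p f with p (f zero)
... | true  = cong suc (length-filter-tabulate p (f ∘ suc))
... | false = length-filter-tabulate p (f ∘ suc)

-- Induced copies of family members and how they are transported

Symmetric : ∀ {n} → Adj n → Set
Symmetric A = ∀ x y → A x y ≡ A y x

Irreflexive : ∀ {n} → Adj n → Set
Irreflexive A = ∀ x → A x x ≡ false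

FamilyMember : (m : ℕ) → Adj m → Set
FamilyMember m A = (Σ ℕ λ ℓ → (3 ≤ ℓ) × Subdivision (wheel ℓ) m A)
  ⊎ Subdivision prism m A ⊎ Subdivision K33 m A

family-sub : ∀ {k B} (u v : Fin k) → B u v ≡ true → FamilyMember k B →
  FamilyMember (suc k) (subdivide B u v)
family-sub u v e (inj₁ (ℓ , h , d))  = inj₁ (ℓ , h , sub u v e d)
family-sub u v e (inj₂ (inj₁ d))     = inj₂ (inj₁ (sub u v e d))
family-sub u v e (inj₂ (inj₂ d))     = inj₂ (inj₂ (sub u v e d))

-- `InducedIso` with the three kinds of graph merged into one field, so that most lifting arguments
-- need not distinguish them, and with a Boolean vertex set.
record Fam {n} (A : Adj n) (K : VSet n) : Set where
  constructor mkFam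
  field
    {k}   : ℕ
    {B}   : Adj k
    isMember : FamilyMember k B
    f     : Fin k → Fin n
    inj   : Injective _≡_ _≡_ f
    cover : ∀ {v} → K ∋ v → ∃ λ i → f i ≡ v
    inK   : ∀ i → K ∋ f i
    ind   : ∀ i j → A (f i) (f j) ≡ B i j

full : ∀ {n} → VSet n
full _ = true

-- The conditions on `g` are restricted to `K₁` because some renamings, such as `to-a` below, are
-- injective only there.
fam-map : ∀ {m n} {A₁ : Adj m} {K₁ : VSet m} {A : Adj n} {K : VSet n} → Fam A₁ K₁ →
  (g : Fin m → Fin n) → (∀ {i j} → K₁ ∋ i → K₁ ∋ j → g i ≡ g j → i ≡ j) →
  (∀ {v} → K ∋ v → ∃ λ i → (K₁ ∋ i) × (g i ≡ v)) →
  (∀ {i} → K₁ ∋ i → K ∋ g i) →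
  (∀ {i j} → K₁ ∋ i → K₁ ∋ j → A (g i) (g j) ≡ A₁ i j) → Fam A K
fam-map {K = K} (mkFam b f inj cover inK ind) g g-inj g-cover g-in g-ind =
  mkFam b (g ∘ f) (λ {i} {j} e → inj (g-inj (inK i) (inK j) e)) cov (λ i → g-in (inK i))
    (λ i j → trans (g-ind (inK i) (inK j)) (ind i j))
  where
  cov : ∀ {v} → K ∋ v → ∃ λ i → g (f i) ≡ v
  cov h with g-cover h
  ... | i , ki , e with cover ki
  ...   | j , e′ = j , trans (cong g e′) e

fam-cong : ∀ {n} {A₁ A : Adj n} {K : VSet n} → Fam A₁ K →
  (∀ {x y} → K ∋ x → K ∋ y → A x y ≡ A₁ x y) → Fam A K
fam-cong F h = fam-map F id (λ _ _ e → e) (λ {v} kv → v , kv , refl) id h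

fam-subdivide-full : ∀ {m} {A : Adj m} → Fam A full → ∀ u v → A u v ≡ true →
  Fam (subdivide A u v) full
fam-subdivide-full {A = A} (mkFam {B = B} b f inj cover inK ind) u v e with cover {u} refl | cover {v} refl
... | i , refl | j , refl = mkFam (family-sub i j (trans (≡-sym (ind i j)) e) b) g g-inj g-cov (λ _ → refl) g-ind
  where
  g : Fin _ → Fin _
  g zero    = zero
  g (suc x) = suc (f x)
  g-inj : Injective _≡_ _≡_ g
  g-inj {zero}  {zero}  _  = refl
  g-inj {zero}  {suc y} ()
  g-inj {suc x} {zero}  ()
  g-inj {suc x} {suc y} h  = cong suc (inj (sucᶠ-injective h))
  g-cov : ∀ {v} → full ∋ v → ∃ λ i → g i ≡ v
  g-cov {zero}  _ = zero , refl
  g-cov {suc v} _ with cover {v} refl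
  ... | i , refl = suc i , refl
  eq : ∀ x y → (f x =ᶠ f y) ≡ (x =ᶠ y)
  eq = =ᶠ-injective inj
  g-ind : ∀ x y → subdivide A (f i) (f j) (g x) (g y) ≡ subdivide B i j x y
  g-ind zero    zero    = refl
  g-ind zero    (suc y) rewrite eq y i | eq y j = refl
  g-ind (suc x) zero    rewrite eq x i | eq x j = refl
  g-ind (suc x) (suc y) rewrite eq x i | eq x j | eq y i | eq y j | ind x y = refl

SameEdge : ∀ {n} → (x y u v : Fin n) → Set
SameEdge x y u v = (x ≡ u × y ≡ v) ⊎ (x ≡ v × y ≡ u)

-- The lifting step of suppression and of contraction. Within `K` the two graphs differ only in the
-- edge `u v`, which `A` replaces by the path through `s`; so `s` plays the vertex `zero` of
-- `subdivide`.
fam-subdivide : ∀ {n} {A A₁ : Adj n} {K : VSet n} {u v s} → Symmetric A → Irreflexive A →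
  Fam A₁ K → K ∋ u → K ∋ v → K ∌ s → A₁ u v ≡ true →
  (∀ {x y} → K ∋ x → K ∋ y → A x y ≡ true → (A₁ x y ≡ true) × ¬ SameEdge x y u v) →
  (∀ {x y} → K ∋ x → K ∋ y → A₁ x y ≡ true → ¬ SameEdge x y u v → A x y ≡ true) →
  A s u ≡ true → A s v ≡ true → (∀ {x} → K ∋ x → A s x ≡ true → (x ≡ u) ⊎ (x ≡ v)) →
  Fam A (K ⊕ s)
fam-subdivide {A = A} {A₁} {K} {s = s} symA irrA (mkFam {B = B} b f inj cover inK ind) ku kv ks e to from su sv only
  with cover ku | cover kv
... | i , refl | j , refl =
  mkFam (family-sub i j (trans (≡-sym (ind i j)) e) b) g g-inj g-cov g-in g-ind
  where
  g : Fin _ → Fin _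
  g zero    = s
  g (suc x) = f x
  s≢f : ∀ x → s ≢ f x
  s≢f x refl = true≢false (inK x) ks
  g-inj : Injective _≡_ _≡_ g
  g-inj {zero}  {zero}  h = refl
  g-inj {zero}  {suc y} h = ⊥-elim (s≢f y h)
  g-inj {suc x} {zero}  h = ⊥-elim (s≢f x (≡-sym h))
  g-inj {suc x} {suc y} h = cong suc (inj h)
  g-cov : ∀ {v} → K ⊕ s ∋ v → ∃ λ i → g i ≡ v
  g-cov h with ⊕-elim {p = K} h
  ... | inj₂ refl = zero , refl
  ... | inj₁ kv with cover kv
  ...   | i , refl = suc i , refl
  g-in : ∀ x → K ⊕ s ∋ g x
  g-in zero    = ⊕-new K s
  g-in (suc x) = ⊕-old {p = K} (inK x)
  star : ∀ y → A s (f y) ≡ (y =ᶠ i) ∨ (y =ᶠ j)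
  star y = bool-ext to′ from′
    where
    to′ : A s (f y) ≡ true → (y =ᶠ i) ∨ (y =ᶠ j) ≡ true
    to′ h with only (inK y) h
    ... | inj₁ q = ∨-introˡ (≡⇒=ᶠ (inj q))
    ... | inj₂ q = ∨-introʳ {y =ᶠ i} (≡⇒=ᶠ (inj q))
    from′ : (y =ᶠ i) ∨ (y =ᶠ j) ≡ true → A s (f y) ≡ true
    from′ h with ∨-elim {y =ᶠ i} h
    ... | inj₁ q rewrite =ᶠ⇒≡ {i = y} q = su
    ... | inj₂ q rewrite =ᶠ⇒≡ {i = y} q = sv
  g-ind : ∀ x y → A (g x) (g y) ≡ subdivide B i j x y
  g-ind zero    zero    = irrA s
  g-ind zero    (suc y) = star y
  g-ind (suc x) zero    = trans (symA (f x) s) (star x)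
  g-ind (suc x) (suc y) = bool-ext to′ from′
    where
    E : Bool
    E = ((x =ᶠ i) ∧ (y =ᶠ j)) ∨ ((x =ᶠ j) ∧ (y =ᶠ i))
    E-elim : E ≡ true → SameEdge (f x) (f y) (f i) (f j)
    E-elim h with ∨-elim {(x =ᶠ i) ∧ (y =ᶠ j)} h
    ... | inj₁ q with ∧-elim {x =ᶠ i} q
    ...   | q₁ , q₂ = inj₁ (cong f (=ᶠ⇒≡ q₁) , cong f (=ᶠ⇒≡ q₂))
    E-elim h | inj₂ q with ∧-elim {x =ᶠ j} q
    ...   | q₁ , q₂ = inj₂ (cong f (=ᶠ⇒≡ q₁) , cong f (=ᶠ⇒≡ q₂))
    E-intro : SameEdge (f x) (f y) (f i) (f j) → E ≡ true
    E-intro (inj₁ (p , q)) = ∨-introˡ (∧-intro (≡⇒=ᶠ (inj p)) (≡⇒=ᶠ (inj q)))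
    E-intro (inj₂ (p , q)) = ∨-introʳ {(x =ᶠ i) ∧ (y =ᶠ j)} (∧-intro (≡⇒=ᶠ (inj p)) (≡⇒=ᶠ (inj q)))
    to′ : A (f x) (f y) ≡ true → B x y ∧ not E ≡ true
    to′ h with to (inK x) (inK y) h
    ... | p , q = ∧-intro (trans (≡-sym (ind x y)) p) (not-false (q ∘ E-elim))
    from′ : B x y ∧ not E ≡ true → A (f x) (f y) ≡ true
    from′ h with ∧-elim {B x y} h
    ... | p , q = from (inK x) (inK y) (trans (ind x y) p) (λ se → true≢false (E-intro se) (not-true q))

-- Splitting a vertex of degree four

-- The new vertex zero takes over the neighbours p and q of h and is joined to h.
split : ∀ {k} → Adj k → (h p q : Fin k) → Adj (suc k)
split B h p q zero    zero    = false
split B h p q zero    (suc j) = (j =ᶠ h) ∨ (j =ᶠ p) ∨ (j =ᶠ q)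
split B h p q (suc i) zero    = (i =ᶠ h) ∨ (i =ᶠ p) ∨ (i =ᶠ q)
split B h p q (suc i) (suc j) =
  B i j ∧ not (((i =ᶠ h) ∧ ((j =ᶠ p) ∨ (j =ᶠ q))) ∨ ((j =ᶠ h) ∧ ((i =ᶠ p) ∨ (i =ᶠ q))))

-- Subdividing and splitting both place their new vertex at `zero`. Performing them in the two
-- possible orders therefore gives graphs that differ by an exchange of the first two vertices.
swap₀₁ : ∀ {k} → Fin (suc (suc k)) → Fin (suc (suc k))
swap₀₁ zero          = suc zero
swap₀₁ (suc zero)    = zero
swap₀₁ (suc (suc i)) = suc (suc i)

swap₀₁-involutive : ∀ {k} (i : Fin (suc (suc k))) → swap₀₁ (swap₀₁ i) ≡ i
swap₀₁-involutive zero          = refl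
swap₀₁-involutive (suc zero)    = refl
swap₀₁-involutive (suc (suc i)) = refl

fam-swap₀₁ : ∀ {k} {A₁ A : Adj (suc (suc k))} → Fam A₁ full →
  (∀ i j → A (swap₀₁ i) (swap₀₁ j) ≡ A₁ i j) → Fam A full
fam-swap₀₁ F h = fam-map F swap₀₁
  (λ {x} {y} _ _ e → trans (≡-sym (swap₀₁-involutive x)) (trans (cong swap₀₁ e) (swap₀₁-involutive y)))
  (λ {v} _ → swap₀₁ v , refl , swap₀₁-involutive v) (λ _ → refl) (λ _ _ → h _ _)

∧-swapʳ : ∀ a b c → (a ∧ b) ∧ c ≡ (a ∧ c) ∧ b
∧-swapʳ false b c = refl
∧-swapʳ true  b c = ∧-comm b c

module _ {k} {B : Adj k} {h u v : Fin k} (h≢u : h ≢ u) (h≢v : h ≢ v) where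

  fam-split-away : ∀ {p q} → Fam (split B h p q) full → B u v ≡ true →
    Fam (split (subdivide B u v) (suc h) (suc p) (suc q)) full
  fam-split-away {p} {q} F e = fam-swap₀₁ (fam-subdivide-full F (suc u) (suc v) e′) adj′
    where
    uh : (u =ᶠ h) ≡ false
    uh = ≢⇒=ᶠ (h≢u ∘ ≡-sym)
    vh : (v =ᶠ h) ≡ false
    vh = ≢⇒=ᶠ (h≢v ∘ ≡-sym)
    e′ : split B h p q (suc u) (suc v) ≡ true
    e′ rewrite uh | vh | e = refl
    keep : ∀ j → ((j =ᶠ u) ∨ (j =ᶠ v)) ∧ not ((j =ᶠ h) ∧ false) ≡ (j =ᶠ u) ∨ (j =ᶠ v)
    keep j rewrite ∧-zeroʳ (j =ᶠ h) = ∧-identityʳ _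
    keep′ : ∀ j → ((j =ᶠ u) ∨ (j =ᶠ v)) ∧ not (((j =ᶠ h) ∧ false) ∨ false) ≡ (j =ᶠ u) ∨ (j =ᶠ v)
    keep′ j rewrite ∧-zeroʳ (j =ᶠ h) = ∧-identityʳ _
    adj′ : ∀ i j → split (subdivide B u v) (suc h) (suc p) (suc q) (swap₀₁ i) (swap₀₁ j)
                 ≡ subdivide (split B h p q) (suc u) (suc v) i j
    adj′ zero          zero          = refl
    adj′ zero          (suc zero)    = refl
    adj′ zero          (suc (suc j)) = keep j
    adj′ (suc zero)    zero          = refl
    adj′ (suc zero)    (suc zero)    = refl
    adj′ (suc zero)    (suc (suc j)) = ≡-sym (∧-identityʳ _)
    adj′ (suc (suc i)) zero          = keep′ i
    adj′ (suc (suc i)) (suc zero)    = ≡-sym (trans (cong (λ b → _ ∧ not b) (cong₂ _∨_ (∧-zeroʳ (i =ᶠ u)) (∧-zeroʳ (i =ᶠ v)))) (∧-identityʳ _))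
    adj′ (suc (suc i)) (suc (suc j)) = ∧-swapʳ (B i j) _ _

module _ {k} {B : Adj k} {h v : Fin k} (v≢h : v ≢ h) where

  private
    hv : (h =ᶠ v) ≡ false
    hv = ≢⇒=ᶠ (v≢h ∘ ≡-sym)
    vh : (v =ᶠ h) ≡ false
    vh = ≢⇒=ᶠ v≢h

  -- The subdivided edge `h v` stays with `h`, so subdividing it commutes with the split.
  fam-split-old : ∀ {p q} → v ≢ p → v ≢ q → Fam (split B h p q) full → B h v ≡ true →
    Fam (split (subdivide B h v) (suc h) (suc p) (suc q)) full
  fam-split-old {p} {q} v≢p v≢q F e = fam-swap₀₁ (fam-subdivide-full F (suc h) (suc v) e′) adj′
    where
    e′ : split B h p q (suc h) (suc v) ≡ true
    e′ rewrite ≢⇒=ᶠ v≢p | ≢⇒=ᶠ v≢q | vh | ∧-zeroʳ (h =ᶠ h) | e = refl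
    adj′ : ∀ i j → split (subdivide B h v) (suc h) (suc p) (suc q) (swap₀₁ i) (swap₀₁ j)
                 ≡ subdivide (split B h p q) (suc h) (suc v) i j
    adj′ zero          zero          = refl
    adj′ zero          (suc zero)    = refl
    adj′ zero          (suc (suc j)) rewrite ∧-zeroʳ (j =ᶠ h) = ∧-identityʳ _
    adj′ (suc zero)    zero          = refl
    adj′ (suc zero)    (suc zero)    = refl
    adj′ (suc zero)    (suc (suc j)) = ≡-sym (∧-identityʳ _)
    adj′ (suc (suc i)) zero          rewrite ∧-zeroʳ (i =ᶠ h) = ∧-identityʳ _
    adj′ (suc (suc i)) (suc zero)    = ≡-sym (trans (cong (λ b → _ ∧ not b) (cong₂ _∨_ (∧-zeroʳ (i =ᶠ h)) (∧-zeroʳ (i =ᶠ v)))) (∧-identityʳ _))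
    adj′ (suc (suc i)) (suc (suc j)) = ∧-swapʳ (B i j) _ _

  -- Here the subdividing vertex of `h v` is one of the neighbours that move. Before the subdivision
  -- it is `v` itself that moves, and the edge to subdivide afterwards is the one from the split-off
  -- vertex to `v`.
  fam-split-new : ∀ {q} → v ≢ q → Fam (split B h v q) full →
    Fam (split (subdivide B h v) (suc h) zero (suc q)) full
  fam-split-new {q} v≢q F = fam-swap₀₁ (fam-subdivide-full F zero (suc v) e′) adj′
    where
    e′ : split B h v q zero (suc v) ≡ true
    e′ = ∨-introʳ {v =ᶠ h} (∨-introˡ (≡⇒=ᶠ {i = v} refl))
    only-v : ∀ j → ((j =ᶠ h) ∨ (j =ᶠ v)) ∧ not ((j =ᶠ h) ∧ true) ≡ (j =ᶠ v)
    only-v j with j ≟ h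
    ... | yes refl rewrite ≡⇒=ᶠ {i = j} refl = ≡-sym hv
    ... | no ne rewrite ≢⇒=ᶠ ne = ∧-identityʳ _
    not-v : ∀ j → (j =ᶠ h) ∨ (j =ᶠ q) ≡ ((j =ᶠ h) ∨ (j =ᶠ v) ∨ (j =ᶠ q)) ∧ not (j =ᶠ v)
    not-v j with j ≟ v
    ... | yes refl rewrite ≡⇒=ᶠ {i = j} refl | vh | ≢⇒=ᶠ v≢q = refl
    ... | no ne rewrite ≢⇒=ᶠ ne = ≡-sym (∧-identityʳ _)
    -- Both sides delete the edges `h v` and `h q` from `B`, the left one in two rounds. The final
    -- `true` comes from subdividing an edge at the split-off vertex, which deletes nothing between
    -- old vertices.
    cut : ∀ b ih iv iq jh jv jq →
      (b ∧ not ((ih ∧ jv) ∨ (iv ∧ jh))) ∧ not ((ih ∧ jq) ∨ (jh ∧ iq))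
      ≡ (b ∧ not ((ih ∧ (jv ∨ jq)) ∨ (jh ∧ (iv ∨ iq)))) ∧ true
    cut false ih iv iq jh jv jq = refl
    cut true false false iq false jv jq = refl
    cut true false true iq false jv jq = refl
    cut true false false false true jv jq = refl
    cut true false false true true jv jq = refl
    cut true false true iq true jv jq = refl
    cut true true iv iq jh true jq = refl
    cut true true false iq false false false = refl
    cut true true false false true false false = refl
    cut true true false true true false false = refl
    cut true true true iq false false false = refl
    cut true true true iq true false false = refl
    cut true true false iq false false true = refl
    cut true true false iq true false true = refl
    cut true true true iq false false true = refl
    cut true true true iq true false true = refl
    adj′ : ∀ i j → split (subdivide B h v) (suc h) zero (suc q) (swap₀₁ i) (swap₀₁ j)
                 ≡ subdivide (split B h v q) zero (suc v) i j
    adj′ zero          zero          = refl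
    adj′ zero          (suc zero)    = refl
    adj′ zero          (suc (suc j)) = only-v j
    adj′ (suc zero)    zero          = refl
    adj′ (suc zero)    (suc zero)    = refl
    adj′ (suc zero)    (suc (suc j)) = trans (not-v j) (cong (λ b → ((j =ᶠ h) ∨ (j =ᶠ v) ∨ (j =ᶠ q)) ∧ not b) (≡-sym (∨-identityʳ (j =ᶠ v))))
    adj′ (suc (suc i)) zero          =
      trans (cong (λ b → ((i =ᶠ h) ∨ (i =ᶠ v)) ∧ not b) (∨-identityʳ ((i =ᶠ h) ∧ true))) (only-v i)
    adj′ (suc (suc i)) (suc zero)    =
      trans (not-v i) (cong (λ b → ((i =ᶠ h) ∨ (i =ᶠ v) ∨ (i =ᶠ q)) ∧ not b) (≡-sym (∧-identityʳ (i =ᶠ v))))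
    adj′ (suc (suc i)) (suc (suc j)) =
      trans (cut (B i j) (i =ᶠ h) (i =ᶠ v) (i =ᶠ q) (j =ᶠ h) (j =ᶠ v) (j =ᶠ q))
        (cong (λ b → split B h v q (suc i) (suc j) ∧ not b) (≡-sym (∧-zeroʳ (i =ᶠ v))))

split-cong : ∀ {k} {B₁ B₂ : Adj k} → (∀ i j → B₁ i j ≡ B₂ i j) → ∀ h p q i j →
  split B₁ h p q i j ≡ split B₂ h p q i j
split-cong e h p q zero    zero    = refl
split-cong e h p q zero    (suc j) = refl
split-cong e h p q (suc i) zero    = refl
split-cong e h p q (suc i) (suc j) = cong (_∧ _) (e i j)

split-comm : ∀ {k} (B : Adj k) h p q i j → split B h p q i j ≡ split B h q p i j
split-comm B h p q zero    zero    = refl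
split-comm B h p q zero    (suc j) = cong ((j =ᶠ h) ∨_) (∨-comm (j =ᶠ p) _)
split-comm B h p q (suc i) zero    = cong ((i =ᶠ h) ∨_) (∨-comm (i =ᶠ p) _)
split-comm B h p q (suc i) (suc j) rewrite ∨-comm (i =ᶠ p) (i =ᶠ q) | ∨-comm (j =ᶠ p) (j =ᶠ q) = refl

subdivide-comm : ∀ {k} (B : Adj k) u v i j → subdivide B u v i j ≡ subdivide B v u i j
subdivide-comm B u v zero    zero    = refl
subdivide-comm B u v zero    (suc j) = ∨-comm (j =ᶠ u) _
subdivide-comm B u v (suc i) zero    = ∨-comm (i =ᶠ u) _
subdivide-comm B u v (suc i) (suc j) = cong (λ b → B i j ∧ not b) (∨-comm ((i =ᶠ u) ∧ (j =ᶠ v)) _)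

subdivide-symmetric : ∀ {k} {B : Adj k} u v → Symmetric B → Symmetric (subdivide B u v)
subdivide-symmetric u v s zero    zero    = refl
subdivide-symmetric u v s zero    (suc j) = refl
subdivide-symmetric u v s (suc i) zero    = refl
subdivide-symmetric u v s (suc i) (suc j) rewrite s i j
  | ∧-comm (i =ᶠ u) (j =ᶠ v) | ∧-comm (i =ᶠ v) (j =ᶠ u) =
  cong (λ b → _ ∧ not b) (∨-comm ((j =ᶠ v) ∧ (i =ᶠ u)) _)

subdivide-irreflexive : ∀ {k} {B : Adj k} u v → Irreflexive B → Irreflexive (subdivide B u v)
subdivide-irreflexive u v r zero    = refl
subdivide-irreflexive u v r (suc i) = cong (_∧ _) (r i)

subdivision-symmetric : ∀ {m A k B} → Subdivision {m} A k B → Symmetric A → Symmetric B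
subdivision-symmetric base          s = s
subdivision-symmetric (sub u v _ d) s = subdivide-symmetric u v (subdivision-symmetric d s)

subdivision-irreflexive : ∀ {m A k B} → Subdivision {m} A k B → Irreflexive A → Irreflexive B
subdivision-irreflexive base          r = r
subdivision-irreflexive (sub u v _ d) r = subdivide-irreflexive u v (subdivision-irreflexive d r)

-- Only degree four matters: contracting an edge between two vertices of degree three creates a
-- vertex with at most four neighbours in a copy, and lifting splits just that vertex. Which
-- neighbours move is dictated by the original graph, so every choice of `p` and `q` must be
-- allowed.
Splittable : ∀ {k} → Adj k → Set
Splittable {k} B = ∀ {h p q : Fin k} → count (B h) ≡ 4 → B h p ≡ true → B h q ≡ true → p ≢ q →
  Fam (split B h p q) full

count-subdivided : ∀ {k} {B : Adj k} {h v : Fin k} → v ≢ h → B h v ≡ true →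
  count (subdivide B h v (suc h)) ≡ count (B h)
count-subdivided {B = B} {h} {v} v≢h e rewrite ≡⇒=ᶠ {i = h} refl | ≢⇒=ᶠ (v≢h ∘ ≡-sym) =
  trans (cong suc (count-cong λ j → cong (λ b → B h j ∧ not b) (∨-identityʳ (j =ᶠ v))))
        (≡-sym (count-remove {p = B h} e))

-- The subdividing vertex `zero` stands for `v` among the neighbours of `h`. If it is `p` or `q`,
-- then `v` moves in the split of `B`; otherwise the subdivided edge stays at `h`.
splittable-hub : ∀ {k} {B : Adj k} {h v : Fin k} → Irreflexive B → B h v ≡ true → Splittable B →
  ∀ {p q} → count (subdivide B h v (suc h)) ≡ 4 →
  subdivide B h v (suc h) p ≡ true → subdivide B h v (suc h) q ≡ true → p ≢ q →
  Fam (split (subdivide B h v) (suc h) p q) full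
splittable-hub {k} {B} {h} {v} irr e spl {p} {q} c hp hq p≢q = go p q hp hq p≢q
  where
  v≢h : v ≢ h
  v≢h refl = true≢false e (irr v)
  c′ : count (B h) ≡ 4
  c′ = trans (≡-sym (count-subdivided {B = B} v≢h e)) c
  old : ∀ {x} → subdivide B h v (suc h) (suc x) ≡ true → (B h x ≡ true) × (v ≢ x)
  old {x} m with ∧-elim {B h x} m
  ... | a , b = a , λ { refl → true≢false
        (∨-introˡ (∧-intro (≡⇒=ᶠ {i = h} refl) (≡⇒=ᶠ {i = v} refl))) (not-true b) }
  go : ∀ p q → subdivide B h v (suc h) p ≡ true → subdivide B h v (suc h) q ≡ true → p ≢ q →
    Fam (split (subdivide B h v) (suc h) p q) full
  go zero    zero    _ _ ne = ⊥-elim (ne refl)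
  go zero    (suc q) _ m ne with old m
  ... | a , vq = fam-split-new v≢h vq (spl c′ e a vq)
  go (suc p) zero    m _ ne with old m
  ... | a , vp = fam-cong (fam-split-new v≢h vp (spl c′ e a vp))
                   (λ {x} {y} _ _ → split-comm (subdivide B h v) (suc h) (suc p) zero x y)
  go (suc p) (suc q) m m′ ne with old m | old m′
  ... | a , vp | b , vq = fam-split-old v≢h vp vq (spl c′ a b (ne ∘ cong suc)) e

count-new : ∀ {k} {B : Adj k} (u v : Fin k) → count (subdivide B u v zero) ≤ 2
count-new {k} u v =
  ≤-trans (count-remove≤ P u) (s≤s (≤-trans (count-remove≤ (P ∖ u) v)
    (s≤s (≤-reflexive (count-empty none)))))
  where
  P : VSet k
  P j = (j =ᶠ u) ∨ (j =ᶠ v)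
  bad : ∀ {x} → P ∖ u ∖ v ∋ x → ⊥
  bad {x} h with ∖-elim {p = P ∖ u} {v} {x} h
  ... | h₁ , xv with ∖-elim {p = P} {u} {x} h₁
  ...   | h₂ , xu with ∨-elim {x =ᶠ u} h₂
  ...     | inj₁ e = xu (=ᶠ⇒≡ e)
  ...     | inj₂ e = xv (=ᶠ⇒≡ e)
  none : ∀ x → P ∖ u ∖ v ∌ x
  none x = ¬true⇒false (bad {x})

-- The subdividing vertex has degree two, so `h` is an old vertex, and its degree is unchanged. If
-- the edge misses `h`, subdividing commutes with splitting; if it ends at `h`, `splittable-hub`
-- applies, after exchanging the ends when `h` is `v`.
splittable-sub : ∀ {k} {B : Adj k} (u v : Fin k) → Symmetric B → Irreflexive B → B u v ≡ true →
  Splittable B → Splittable (subdivide B u v)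
splittable-sub {B = B} u v symB irr e spl {zero} {p} {q} c _ _ _ =
  ⊥-elim (bad (subst (_≤ 2) c (count-new {B = B} u v)))
  where
  bad : 4 ≤ 2 → ⊥
  bad (s≤s (s≤s ()))
splittable-sub {k} {B} u v symB irr e spl {suc h} {p} {q} c hp hq p≢q with h ≟ u | h ≟ v
... | yes refl | _        = splittable-hub irr e spl c hp hq p≢q
... | no _     | yes refl =
  fam-cong (splittable-hub irr (trans (symB v u) e) spl
      (trans (count-cong (comm′ (suc v))) c)
      (trans (comm′ (suc v) p) hp) (trans (comm′ (suc v) q) hq) p≢q)
    (λ {x} {y} _ _ → split-cong (λ i j → ≡-sym (comm′ i j)) (suc v) p q x y)
  where
  comm′ : ∀ i j → subdivide B v u i j ≡ subdivide B u v i j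
  comm′ = subdivide-comm B v u
... | no h≢u   | no h≢v = go p q hp hq p≢q
  where
  z : subdivide B u v (suc h) zero ≡ false
  z rewrite ≢⇒=ᶠ h≢u | ≢⇒=ᶠ h≢v = refl
  same : ∀ j → subdivide B u v (suc h) (suc j) ≡ B h j
  same j rewrite ≢⇒=ᶠ h≢u | ≢⇒=ᶠ h≢v = ∧-identityʳ (B h j)
  c′ : count (B h) ≡ 4
  c′ = trans (≡-sym (trans (cong (λ b → bit b + count (λ j → subdivide B u v (suc h) (suc j))) z) (count-cong same))) c
  go : ∀ p q → subdivide B u v (suc h) p ≡ true → subdivide B u v (suc h) q ≡ true → p ≢ q →
    Fam (split (subdivide B u v) (suc h) p q) full
  go zero    _       m _  _ = ⊥-elim (true≢false m z)
  go (suc p) zero    _ m  _ = ⊥-elim (true≢false m z)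
  go (suc p) (suc q) m m′ ne = fam-split-away h≢u h≢v
    (spl c′ (trans (≡-sym (same p)) m) (trans (≡-sym (same q)) m′) (ne ∘ cong suc)) e

subdivision-splittable : ∀ {m A k B} → Symmetric A → Irreflexive A → Splittable A →
  Subdivision {m} A k B → Splittable B
subdivision-splittable s r spl base            = spl
subdivision-splittable s r spl (sub u v e d) =
  splittable-sub u v (subdivision-symmetric d s) (subdivision-irreflexive d r) e
    (subdivision-splittable s r spl d)

-- Wheels: degrees on the rim and the splitting of the hub

RimNext : ℕ → ℕ → ℕ → Set
RimNext ℓ a b = (suc a ≡ b) ⊎ (suc a ≡ ℓ × b ≡ 0)

-- Together with `rimNext-injective` this gives a rim vertex at most one successor and one
-- predecessor, hence at most two rim neighbours.
rimNext-functional : ∀ {ℓ a b b′} → b < ℓ → b′ < ℓ → RimNext ℓ a b → RimNext ℓ a b′ → b ≡ b′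
rimNext-functional _ _  (inj₁ refl)          (inj₁ refl)          = refl
rimNext-functional l _  (inj₁ refl)          (inj₂ (refl , refl)) = ⊥-elim (<-irrefl refl l)
rimNext-functional _ l′ (inj₂ (refl , refl)) (inj₁ refl)          = ⊥-elim (<-irrefl refl l′)
rimNext-functional _ _  (inj₂ (_ , refl))    (inj₂ (_ , refl))    = refl

rimNext-injective : ∀ {ℓ a a′ b} → RimNext ℓ a b → RimNext ℓ a′ b → a ≡ a′
rimNext-injective (inj₁ refl)          (inj₁ refl)       = refl
rimNext-injective (inj₁ refl)          (inj₂ (_ , ()))
rimNext-injective (inj₂ (_ , ()))      (inj₁ refl)
rimNext-injective (inj₂ (refl , refl)) (inj₂ (refl , _)) = refl

rimNext-irreflexive : ∀ {ℓ a} → 3 ≤ ℓ → RimNext ℓ a a → ⊥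
rimNext-irreflexive (s≤s ()) (inj₂ (refl , refl))

rim-elim : ∀ ℓ (i j : Fin ℓ) → wheel ℓ (suc i) (suc j) ≡ true →
  RimNext ℓ (toℕ i) (toℕ j) ⊎ RimNext ℓ (toℕ j) (toℕ i)
rim-elim ℓ i j h with ∨-elim {suc (toℕ i) ≡ᵇ toℕ j} h
... | inj₁ e = inj₁ (inj₁ (≡ᵇ-true e))
... | inj₂ h₁ with ∨-elim {suc (toℕ j) ≡ᵇ toℕ i} h₁
...   | inj₁ e = inj₂ (inj₁ (≡ᵇ-true e))
...   | inj₂ h₂ with ∨-elim {(toℕ i ≡ᵇ 0) ∧ (suc (toℕ j) ≡ᵇ ℓ)} h₂
...     | inj₁ e with ∧-elim {toℕ i ≡ᵇ 0} e
...       | e₁ , e₂ = inj₂ (inj₂ (≡ᵇ-true e₂ , ≡ᵇ-true {toℕ i} e₁))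
rim-elim ℓ i j h | inj₂ h₁ | inj₂ h₂ | inj₂ e with ∧-elim {toℕ j ≡ᵇ 0} e
...       | e₁ , e₂ = inj₁ (inj₂ (≡ᵇ-true e₂ , ≡ᵇ-true {toℕ j} e₁))

rim-intro : ∀ ℓ (i j : Fin ℓ) → RimNext ℓ (toℕ i) (toℕ j) ⊎ RimNext ℓ (toℕ j) (toℕ i) →
  wheel ℓ (suc i) (suc j) ≡ true
rim-intro ℓ i j (inj₁ (inj₁ e)) = ∨-introˡ (≡ᵇ-intro e)
rim-intro ℓ i j (inj₂ (inj₁ e)) =
  ∨-introʳ {suc (toℕ i) ≡ᵇ toℕ j} (∨-introˡ (≡ᵇ-intro e))
rim-intro ℓ i j (inj₂ (inj₂ (e , e′))) =
  ∨-introʳ {suc (toℕ i) ≡ᵇ toℕ j} (∨-introʳ {suc (toℕ j) ≡ᵇ toℕ i}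
    (∨-introˡ (∧-intro (≡ᵇ-intro {toℕ i} e′) (≡ᵇ-intro e))))
rim-intro ℓ i j (inj₁ (inj₂ (e , e′))) =
  ∨-introʳ {suc (toℕ i) ≡ᵇ toℕ j} (∨-introʳ {suc (toℕ j) ≡ᵇ toℕ i}
    (∨-introʳ {(toℕ i ≡ᵇ 0) ∧ (suc (toℕ j) ≡ᵇ ℓ)} (∧-intro (≡ᵇ-intro {toℕ j} e′) (≡ᵇ-intro e))))

wheel-symmetric : ∀ ℓ → Symmetric (wheel ℓ)
wheel-symmetric ℓ zero    zero    = refl
wheel-symmetric ℓ zero    (suc j) = refl
wheel-symmetric ℓ (suc i) zero    = refl
wheel-symmetric ℓ (suc i) (suc j) =
  bool-ext (λ h → rim-intro ℓ j i (⊎-swap (rim-elim ℓ i j h)))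
           (λ h → rim-intro ℓ i j (⊎-swap (rim-elim ℓ j i h)))

wheel-irreflexive : ∀ {ℓ} → 3 ≤ ℓ → Irreflexive (wheel ℓ)
wheel-irreflexive     l zero    = refl
wheel-irreflexive {ℓ} l (suc i) = ¬true⇒false λ h → bad (rim-elim ℓ i i h)
  where
  bad : RimNext ℓ (toℕ i) (toℕ i) ⊎ RimNext ℓ (toℕ i) (toℕ i) → ⊥
  bad (inj₁ r) = rimNext-irreflexive l r
  bad (inj₂ r) = rimNext-irreflexive l r

-- Besides the hub there would be three neighbours on the rim, and two of them would both be
-- successors or both be predecessors of `i`.
rim-degree : ∀ ℓ (i : Fin ℓ) → count (wheel ℓ (suc i)) ≢ 4
rim-degree ℓ i c with three-elements {p = λ j → wheel ℓ (suc i) (suc j)} (suc-injective c)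
... | x , y , z , t = clash (rim-elim ℓ i x (Three.in₁ t)) (rim-elim ℓ i y (Three.in₂ t)) (rim-elim ℓ i z (Three.in₃ t))
  where
  Side : Fin ℓ → Set
  Side j = RimNext ℓ (toℕ i) (toℕ j) ⊎ RimNext ℓ (toℕ j) (toℕ i)
  fwd : ∀ {j j′ : Fin ℓ} → RimNext ℓ (toℕ i) (toℕ j) → RimNext ℓ (toℕ i) (toℕ j′) → j ≡ j′
  fwd r r′ = toℕ-injective (rimNext-functional (toℕ<n _) (toℕ<n _) r r′)
  bwd : ∀ {j j′ : Fin ℓ} → RimNext ℓ (toℕ j) (toℕ i) → RimNext ℓ (toℕ j′) (toℕ i) → j ≡ j′
  bwd r r′ = toℕ-injective (rimNext-injective r r′)
  clash : Side x → Side y → Side z → ⊥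
  clash (inj₁ a) (inj₁ b) _        = Three.a≢b t (fwd a b)
  clash (inj₂ a) (inj₂ b) _        = Three.a≢b t (bwd a b)
  clash (inj₁ a) (inj₂ b) (inj₁ c) = Three.a≢c t (fwd a c)
  clash (inj₁ a) (inj₂ b) (inj₂ c) = Three.b≢c t (bwd b c)
  clash (inj₂ a) (inj₁ b) (inj₁ c) = Three.b≢c t (fwd b c)
  clash (inj₂ a) (inj₁ b) (inj₂ c) = Three.a≢c t (bwd a c)

count-full : ∀ n → count {n} full ≡ n
count-full zero    = refl
count-full (suc n) = cong suc (count-full n)

fam-by-evaluation : ∀ {k} {A B : Adj k} → FamilyMember k B → (f : Fin k → Fin k) →
  {True (all? λ i → all? λ j → (f i ≟ f j) →-dec (i ≟ j))} →
  {True (all? λ v → any? λ i → f i ≟ v)} →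
  {True (all? λ i → all? λ j → A (f i) (f j) ≟ᵇ B i j)} →
  Fam A full
fam-by-evaluation b f {x} {y} {z} =
  mkFam b f (λ {i} {j} → toWitness x i j) (λ {v} _ → toWitness y v) (λ _ → refl) (toWitness z)

-- If consecutive rim vertices move, they form a triangle with the new vertex, the other two form
-- one with the hub, and the result is the prism. If opposite rim vertices move, one class of `K33`
-- is the new vertex with the two that stay, the other is the hub with the two that move. In the
-- lists 0 is the new vertex, 1 the hub, and 2 to 5 the rim.
wheel₄-splittable : ∀ i j → i ≢ j → Fam (split (wheel 4) zero (suc i) (suc j)) full
wheel₄-splittable = λ where
    0F 0F ne → ⊥-elim (ne refl)
    1F 1F ne → ⊥-elim (ne refl)
    2F 2F ne → ⊥-elim (ne refl)
    3F 3F ne → ⊥-elim (ne refl)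
    0F 1F _ → s01
    1F 0F _ → flip s01
    1F 2F _ → s12
    2F 1F _ → flip s12
    2F 3F _ → s23
    3F 2F _ → flip s23
    3F 0F _ → s30
    0F 3F _ → flip s30
    0F 2F _ → s02
    2F 0F _ → flip s02
    1F 3F _ → s13
    3F 1F _ → flip s13
  where
  flip : ∀ {p q} → Fam (split (wheel 4) zero p q) full → Fam (split (wheel 4) zero q p) full
  flip {p} {q} F = fam-cong F λ {x} {y} _ _ → split-comm (wheel 4) zero q p x y
  tri : FamilyMember 6 prism
  tri = inj₂ (inj₁ base)
  bip : FamilyMember 6 K33
  bip = inj₂ (inj₂ base)
  s01 : Fam (split (wheel 4) zero (suc 0F) (suc 1F)) full
  s01 = fam-by-evaluation tri (lookup (0F ∷ 2F ∷ 3F ∷ 1F ∷ 5F ∷ 4F ∷ []))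
  s12 : Fam (split (wheel 4) zero (suc 1F) (suc 2F)) full
  s12 = fam-by-evaluation tri (lookup (0F ∷ 3F ∷ 4F ∷ 1F ∷ 2F ∷ 5F ∷ []))
  s23 : Fam (split (wheel 4) zero (suc 2F) (suc 3F)) full
  s23 = fam-by-evaluation tri (lookup (0F ∷ 4F ∷ 5F ∷ 1F ∷ 3F ∷ 2F ∷ []))
  s30 : Fam (split (wheel 4) zero (suc 3F) (suc 0F)) full
  s30 = fam-by-evaluation tri (lookup (0F ∷ 5F ∷ 2F ∷ 1F ∷ 4F ∷ 3F ∷ []))
  s02 : Fam (split (wheel 4) zero (suc 0F) (suc 2F)) full
  s02 = fam-by-evaluation bip (lookup (0F ∷ 3F ∷ 5F ∷ 1F ∷ 2F ∷ 4F ∷ []))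
  s13 : Fam (split (wheel 4) zero (suc 1F) (suc 3F)) full
  s13 = fam-by-evaluation bip (lookup (0F ∷ 2F ∷ 4F ∷ 1F ∷ 3F ∷ 5F ∷ []))

wheel-splittable : ∀ ℓ → Splittable (wheel ℓ)
wheel-splittable ℓ {suc i} {p}     {q}     c _ _ _ = ⊥-elim (rim-degree ℓ i c)
wheel-splittable ℓ {zero}  {zero}  {q}     c () _ _
wheel-splittable ℓ {zero}  {suc i} {zero}  c _ () _
-- The hub has degree `ℓ`, so degree four leaves only the wheel with four spokes.
wheel-splittable ℓ {zero}  {suc i} {suc j} c _ _ ne with trans (≡-sym (count-full ℓ)) c
... | refl = wheel₄-splittable i j (ne ∘ cong suc)

cubic-splittable : ∀ {k} {B : Adj k} → (∀ h → count (B h) ≡ 3) → Splittable B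
cubic-splittable d {h} c with trans (≡-sym c) (d h)
... | ()

family-splittable : ∀ {k B} → FamilyMember k B → Splittable B
family-splittable (inj₁ (ℓ , l , d)) =
  subdivision-splittable (wheel-symmetric ℓ) (wheel-irreflexive l) (wheel-splittable ℓ) d
family-splittable (inj₂ (inj₁ d)) = subdivision-splittable
  (toWitness {a? = all? λ i → all? λ j → prism i j ≟ᵇ prism j i} _)
  (toWitness {a? = all? λ i → prism i i ≟ᵇ false} _)
  (cubic-splittable (toWitness {a? = all? λ i → count (prism i) ≟ⁿ 3} _)) d
family-splittable (inj₂ (inj₂ d)) = subdivision-splittable
  (toWitness {a? = all? λ i → all? λ j → K33 i j ≟ᵇ K33 j i} _)
  (toWitness {a? = all? λ i → K33 i i ≟ᵇ false} _)
  (cubic-splittable (toWitness {a? = all? λ i → count (K33 i) ≟ⁿ 3} _)) d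

-- Lifting a split to an induced copy

Four : ∀ {n} (a b c d : Fin n) → Set
Four a b c d = (a ≢ b) × (a ≢ c) × (a ≢ d) × (b ≢ c) × (b ≢ d) × (c ≢ d)

count-four : ∀ {n} {P : VSet n} {a b c d} → P ∋ a → P ∋ b → P ∋ c → P ∋ d → Four a b c d →
  (∀ {x} → P ∋ x → (x ≡ a) ⊎ (x ≡ b) ⊎ (x ≡ c) ⊎ (x ≡ d)) → count P ≡ 4
count-four {P = P} {a} {b} {c} {d} pa pb pc pd (ab , ac , ad , bc , bd , cd) all =
  trans (count-remove {p = P} pa) (cong suc
  (trans (count-remove {p = P ∖ a} (∖-intro {p = P} pb (ab ∘ ≡-sym))) (cong suc
  (trans (count-remove {p = P ∖ a ∖ b} (∖-intro {p = P ∖ a} (∖-intro {p = P} pc (ac ∘ ≡-sym)) (bc ∘ ≡-sym))) (cong suc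
  (trans (count-remove {p = P ∖ a ∖ b ∖ c} (∖-intro {p = P ∖ a ∖ b} (∖-intro {p = P ∖ a} (∖-intro {p = P} pd (ad ∘ ≡-sym)) (bd ∘ ≡-sym)) (cd ∘ ≡-sym)))
  (cong suc (count-empty none))))))))
  where
  bad : ∀ {x} → P ∖ a ∖ b ∖ c ∖ d ∋ x → ⊥
  bad {x} h with ∖-elim {p = P ∖ a ∖ b ∖ c} {d} {x} h
  ... | h₁ , xd with ∖-elim {p = P ∖ a ∖ b} {c} {x} h₁
  ...   | h₂ , xc with ∖-elim {p = P ∖ a} {b} {x} h₂
  ...     | h₃ , xb with ∖-elim {p = P} {a} {x} h₃
  ...       | h₄ , xa with all h₄
  ...         | inj₁ e = xa e
  ...         | inj₂ (inj₁ e) = xb e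
  ...         | inj₂ (inj₂ (inj₁ e)) = xc e
  ...         | inj₂ (inj₂ (inj₂ e)) = xd e
  none : ∀ x → P ∖ a ∖ b ∖ c ∖ d ∌ x
  none x = ¬true⇒false (bad {x})

-- The counterpart of `fam-subdivide` for a contracted vertex `b` with all four neighbours in `K`:
-- in `A` the vertex `a` takes over `p` and `q`. The four neighbours make `b` a vertex of degree
-- four in the copy, so `family-splittable` applies.
fam-split : ∀ {n} {A A₁ : Adj n} {K : VSet n} {a b p q r s} → Symmetric A → Irreflexive A →
  Fam A₁ K → K ∋ b → K ∋ p → K ∋ q → K ∋ r → K ∋ s → K ∌ a → Four p q r s →
  A₁ b p ≡ true → A₁ b q ≡ true → A₁ b r ≡ true → A₁ b s ≡ true →
  (∀ {x} → K ∋ x → A₁ b x ≡ true → (x ≡ p) ⊎ (x ≡ q) ⊎ (x ≡ r) ⊎ (x ≡ s)) →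
  (∀ {x y} → K ∋ x → K ∋ y → A x y ≡ true →
    (A₁ x y ≡ true) × ¬ SameEdge x y b p × ¬ SameEdge x y b q) →
  (∀ {x y} → K ∋ x → K ∋ y → A₁ x y ≡ true → ¬ SameEdge x y b p → ¬ SameEdge x y b q → A x y ≡ true) →
  A a b ≡ true → A a p ≡ true → A a q ≡ true →
  (∀ {x} → K ∋ x → A a x ≡ true → (x ≡ b) ⊎ (x ≡ p) ⊎ (x ≡ q)) →
  Fam A (K ⊕ a)
fam-split {A = A} {A₁} {K} {a} symA irrA (mkFam {B = B} isMember f inj cover inK ind) kb kp kq kr ks ka
  (pq , pr , ps , qr , qs , rs) ep eq er es only to from ab ap aq star
  with cover kb | cover kp | cover kq | cover kr | cover ks
... | h , refl | p , refl | q , refl | r , refl | s , refl =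
  fam-map (family-splittable isMember {h} {p} {q} four (in-B ep) (in-B eq) (pq ∘ cong f))
    g (λ _ _ → g-inj) g-cov (λ {i} _ → g-in i) (λ {i} {j} _ _ → g-ind i j)
  where
  in-B : ∀ {i} → A₁ (f h) (f i) ≡ true → B h i ≡ true
  in-B = trans (≡-sym (ind h _))
  four : count (B h) ≡ 4
  four = count-four (in-B ep) (in-B eq) (in-B er) (in-B es)
    (pq ∘ cong f , pr ∘ cong f , ps ∘ cong f , qr ∘ cong f , qs ∘ cong f , rs ∘ cong f) all
    where
    all : ∀ {x} → B h x ≡ true → (x ≡ p) ⊎ (x ≡ q) ⊎ (x ≡ r) ⊎ (x ≡ s)
    all {x} e with only (inK x) (trans (ind h x) e)
    ... | inj₁ e₁ = inj₁ (inj e₁)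
    ... | inj₂ (inj₁ e₁) = inj₂ (inj₁ (inj e₁))
    ... | inj₂ (inj₂ (inj₁ e₁)) = inj₂ (inj₂ (inj₁ (inj e₁)))
    ... | inj₂ (inj₂ (inj₂ e₁)) = inj₂ (inj₂ (inj₂ (inj e₁)))
  g : Fin _ → Fin _
  g zero    = a
  g (suc x) = f x
  a≢f : ∀ x → a ≢ f x
  a≢f x refl = true≢false (inK x) ka
  g-inj : Injective _≡_ _≡_ g
  g-inj {zero}  {zero}  h = refl
  g-inj {zero}  {suc y} h = ⊥-elim (a≢f y h)
  g-inj {suc x} {zero}  h = ⊥-elim (a≢f x (≡-sym h))
  g-inj {suc x} {suc y} h = cong suc (inj h)
  g-cov : ∀ {v} → K ⊕ a ∋ v → ∃ λ i → (full ∋ i) × (g i ≡ v)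
  g-cov h with ⊕-elim {p = K} h
  ... | inj₂ refl = zero , refl , refl
  ... | inj₁ kv with cover kv
  ...   | i , refl = suc i , refl , refl
  g-in : ∀ x → K ⊕ a ∋ g x
  g-in zero    = ⊕-new K a
  g-in (suc x) = ⊕-old {p = K} (inK x)
  star′ : ∀ y → A a (f y) ≡ (y =ᶠ h) ∨ (y =ᶠ p) ∨ (y =ᶠ q)
  star′ y = bool-ext to′ from′
    where
    to′ : A a (f y) ≡ true → (y =ᶠ h) ∨ (y =ᶠ p) ∨ (y =ᶠ q) ≡ true
    to′ e with star (inK y) e
    ... | inj₁ e′ = ∨-introˡ (≡⇒=ᶠ (inj e′))
    ... | inj₂ (inj₁ e′) = ∨-introʳ {y =ᶠ h} (∨-introˡ (≡⇒=ᶠ (inj e′)))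
    ... | inj₂ (inj₂ e′) = ∨-introʳ {y =ᶠ h} (∨-introʳ {y =ᶠ p} (≡⇒=ᶠ (inj e′)))
    from′ : (y =ᶠ h) ∨ (y =ᶠ p) ∨ (y =ᶠ q) ≡ true → A a (f y) ≡ true
    from′ e with ∨-elim {y =ᶠ h} e
    ... | inj₁ e₁ rewrite =ᶠ⇒≡ {i = y} e₁ = ab
    ... | inj₂ e₁ with ∨-elim {y =ᶠ p} e₁
    ...   | inj₁ e₂ rewrite =ᶠ⇒≡ {i = y} e₂ = ap
    ...   | inj₂ e₂ rewrite =ᶠ⇒≡ {i = y} e₂ = aq
  g-ind : ∀ x y → A (g x) (g y) ≡ split B h p q x y
  g-ind zero    zero    = irrA a
  g-ind zero    (suc y) = star′ y
  g-ind (suc x) zero    = trans (symA (f x) a) (star′ x)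
  g-ind (suc x) (suc y) = bool-ext to′ from′
    where
    E : Bool
    E = ((x =ᶠ h) ∧ ((y =ᶠ p) ∨ (y =ᶠ q))) ∨ ((y =ᶠ h) ∧ ((x =ᶠ p) ∨ (x =ᶠ q)))
    E-elim : E ≡ true → SameEdge (f x) (f y) (f h) (f p) ⊎ SameEdge (f x) (f y) (f h) (f q)
    E-elim e with ∨-elim {(x =ᶠ h) ∧ ((y =ᶠ p) ∨ (y =ᶠ q))} e
    E-elim e | inj₁ e₁ with ∧-elim {x =ᶠ h} e₁
    ... | e₂ , e₃ with ∨-elim {y =ᶠ p} e₃
    ...   | inj₁ e₄ = inj₁ (inj₁ (cong f (=ᶠ⇒≡ e₂) , cong f (=ᶠ⇒≡ e₄)))
    ...   | inj₂ e₄ = inj₂ (inj₁ (cong f (=ᶠ⇒≡ e₂) , cong f (=ᶠ⇒≡ e₄)))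
    E-elim e | inj₂ e₁ with ∧-elim {y =ᶠ h} e₁
    ... | e₂ , e₃ with ∨-elim {x =ᶠ p} e₃
    ...   | inj₁ e₄ = inj₁ (inj₂ (cong f (=ᶠ⇒≡ e₄) , cong f (=ᶠ⇒≡ e₂)))
    ...   | inj₂ e₄ = inj₂ (inj₂ (cong f (=ᶠ⇒≡ e₄) , cong f (=ᶠ⇒≡ e₂)))
    E-introˡ : SameEdge (f x) (f y) (f h) (f p) → E ≡ true
    E-introˡ (inj₁ (i , j)) = ∨-introˡ (∧-intro (≡⇒=ᶠ (inj i)) (∨-introˡ (≡⇒=ᶠ (inj j))))
    E-introˡ (inj₂ (i , j)) = ∨-introʳ {(x =ᶠ h) ∧ ((y =ᶠ p) ∨ (y =ᶠ q))}
      (∧-intro (≡⇒=ᶠ (inj j)) (∨-introˡ (≡⇒=ᶠ (inj i))))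
    E-introʳ : SameEdge (f x) (f y) (f h) (f q) → E ≡ true
    E-introʳ (inj₁ (i , j)) = ∨-introˡ (∧-intro (≡⇒=ᶠ (inj i)) (∨-introʳ {y =ᶠ p} (≡⇒=ᶠ (inj j))))
    E-introʳ (inj₂ (i , j)) = ∨-introʳ {(x =ᶠ h) ∧ ((y =ᶠ p) ∨ (y =ᶠ q))}
      (∧-intro (≡⇒=ᶠ (inj j)) (∨-introʳ {x =ᶠ p} (≡⇒=ᶠ (inj i))))
    to′ : A (f x) (f y) ≡ true → B x y ∧ not E ≡ true
    to′ e with to (inK x) (inK y) e
    ... | e₁ , np , nq = ∧-intro (trans (≡-sym (ind x y)) e₁) (not-false λ e₂ → no-edge (E-elim e₂))
      where
      no-edge : SameEdge (f x) (f y) (f h) (f p) ⊎ SameEdge (f x) (f y) (f h) (f q) → ⊥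
      no-edge (inj₁ e₂) = np e₂
      no-edge (inj₂ e₂) = nq e₂
    from′ : B x y ∧ not E ≡ true → A (f x) (f y) ≡ true
    from′ e with ∧-elim {B x y} e
    ... | e₁ , e₂ = from (inK x) (inK y) (trans (ind x y) e₁)
      (λ se → true≢false (E-introˡ se) (not-true e₂)) (λ se → true≢false (E-introʳ se) (not-true e₂))

-- Reachability, admissible instances and their solutions

data Reach {n} (A : Adj n) (U : Fin n → Set) (N : VSet n) : Fin n → Set where
  stop : ∀ {u} → N ∋ u → Reach A U N u
  -- As in `WalkIn`, the condition is imposed on all vertices except the first.
  step : ∀ {u w} → A u w ≡ true → U w → Reach A U N w → Reach A U N u

reach-fold : ∀ {n} {A : Adj n} {U : Fin n → Set} {N : VSet n} (P : Fin n → Set) →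
  (∀ {u} → U u → N ∋ u → P u) → (∀ {u w} → U u → A u w ≡ true → U w → P w → P u) →
  ∀ {u} → U u → Reach A U N u → P u
reach-fold P s t uu (stop e)      = s uu e
reach-fold P s t uu (step e uw r) = t uu e uw (reach-fold P s t uw r)

nb : ∀ {n} → VSet n → Adj n → Fin n → VSet n
nb S A u x = S x ∧ A u x

deg : ∀ {n} → VSet n → Adj n → Fin n → ℕ
deg S A u = count (nb S A u)

-- s and t are the only vertices of S whose degree may be less than three; if
-- both are alive they are adjacent. N is the set of vertices of S from which
-- one can leave S.
record Admissible {n} (S : VSet n) (A : Adj n) (N : VSet n) (s t : Fin n) : Set where
  field
    symA    : Symmetric A
    irrA    : Irreflexive A
    paired  : S ∋ s → S ∋ t → A s t ≡ true
    s∈N     : S ∋ s → N ∋ s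
    t∈N     : S ∋ t → N ∋ t
    deg≥3   : ∀ {u} → S ∋ u → u ≢ s → u ≢ t → 3 ≤ deg S A u
    deg≥4   : ∀ {u} → S ∋ u → N ∌ u → 4 ≤ deg S A u
    reach   : ∀ {u} → S ∋ u → Reach A (S ∋_) N u
    -- Excludes sets made up of exempt vertices alone, such as a single edge, which have no
    -- solution.
    other   : ∃ λ u → (S ∋ u) × (u ≢ s) × (u ≢ t)

-- When `S` is the graph without `x` and `N` the neighbourhood of `x`, the field `out` joins every
-- vertex outside `K` to `x`, which gives connectedness of the complement of `K`.
record Solution {n} (S : VSet n) (A : Adj n) (N : VSet n) : Set where
  constructor mkSolution
  field
    K     : VSet n
    K⊆S   : ∀ {x} → K ∋ x → S ∋ x
    fam   : Fam A K
    out   : ∀ {u} → S ∋ u → K ∌ u → Reach A (λ w → (S ∋ w) × (K ∌ w)) N u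

-- The adjacency is quantified too, because suppression and contraction change the graph by adding
-- edges.
Solver : ℕ → ℕ → Set
Solver n m = ∀ {S : VSet n} {A : Adj n} {N : VSet n} {s t} → count S < m → Admissible S A N s t → Solution S A N

admissible-swap : ∀ {n} {S : VSet n} {A N s t} → Admissible S A N s t → Admissible S A N t s
admissible-swap {A = A} {s = s} {t} ad = record
  { symA = symA ; irrA = irrA ; paired = λ a b → trans (symA t s) (paired b a)
  ; s∈N = t∈N ; t∈N = s∈N ; deg≥3 = λ u a b → deg≥3 u b a ; deg≥4 = deg≥4 ; reach = reach
  ; other = let (u , a , b , c) = other in u , a , c , b }
  where open Admissible ad

count-∖< : ∀ {n m} {S : VSet n} {v} → S ∋ v → count S < suc m → count (S ∖ v) < m
count-∖< {S = S} h (s≤s l) = subst (_≤ _) (count-remove {p = S} h) l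

-- Deleting boundary vertices

module _ {n} {S S₁ : VSet n} {A : Adj n} {N N₁ : VSet n} where

  -- A path is followed until it first leaves `S₁`; the vertex before that exit is in `N₁` by the
  -- second hypothesis.
  restrict-reach : (∀ {u} → S₁ ∋ u → N ∋ u → N₁ ∋ u) →
    (∀ {u w} → S₁ ∋ u → S ∋ w → S₁ ∌ w → A u w ≡ true → N₁ ∋ u) →
    ∀ {u} → S ∋ u → Reach A (S ∋_) N u → S₁ ∋ u → Reach A (S₁ ∋_) N₁ u
  restrict-reach keep cut = reach-fold (λ u → S₁ ∋ u → Reach A (S₁ ∋_) N₁ u)
    (λ _ e s → stop (keep s e)) next
    where
    next : ∀ {u w} → S ∋ u → A u w ≡ true → S ∋ w → (S₁ ∋ w → Reach A (S₁ ∋_) N₁ w) →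
      S₁ ∋ u → Reach A (S₁ ∋_) N₁ u
    next {u} {w} _ e sw r s with bool (S₁ w)
    ... | inj₁ s₁ = step e s₁ (r s₁)
    ... | inj₂ s₁ = stop (cut s sw s₁ e)

  -- Removed vertices are outside `K` and in `N`. So a path that ends at a vertex which entered `N₁`
  -- through the removal is prolonged by one step to a removed vertex.
  solution-extend : (∀ {u} → S₁ ∋ u → S ∋ u) → (∀ {u} → S ∋ u → S₁ ∌ u → N ∋ u) →
    (∀ {u} → S₁ ∋ u → N₁ ∋ u → (N ∋ u) ⊎ (∃ λ w → (S ∋ w) × (S₁ ∌ w) × (A u w ≡ true))) →
    Solution S₁ A N₁ → Solution S A N
  solution-extend incl dead new (mkSolution K K⊆ fam out) = mkSolution K (incl ∘ K⊆) fam out′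
    where
    K∌ : ∀ {w} → S₁ ∌ w → K ∌ w
    K∌ s = ¬true⇒false λ k → true≢false (K⊆ k) s
    halt : ∀ {u} → (S₁ ∋ u) × (K ∌ u) → N₁ ∋ u → Reach A (λ w → (S ∋ w) × (K ∌ w)) N u
    halt (s , _) e with new s e
    ... | inj₁ e′ = stop e′
    ... | inj₂ (w , sw , s₁ , e′) = step e′ (sw , K∌ s₁) (stop (dead sw s₁))
    out′ : ∀ {u} → S ∋ u → K ∌ u → Reach A (λ w → (S ∋ w) × (K ∌ w)) N u
    out′ {u} s k with bool (S₁ u)
    ... | inj₂ s₁ = stop (dead s s₁)
    ... | inj₁ s₁ = reach-fold (Reach A (λ w → (S ∋ w) × (K ∌ w)) N) halt
      (λ { _ e (sw , kw) r → step e (incl sw , kw) r }) (s₁ , k) (out s₁ k)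

nb-∖ : ∀ {n} (S : VSet n) (A : Adj n) v u x → nb (S ∖ v) A u x ≡ (nb S A u ∖ v) x
nb-∖ S A v u x = ∧-swapʳ (S x) _ _

deg-∖-adj : ∀ {n} {S : VSet n} {A : Adj n} {v u k} → suc k ≤ deg S A u → k ≤ deg (S ∖ v) A u
deg-∖-adj {S = S} {A} {v} {u} h =
  subst (_ ≤_) (≡-sym (count-cong (nb-∖ S A v u))) (count-remove≥ (nb S A u) v h)

deg-∖-nonadj : ∀ {n} {S : VSet n} {A : Adj n} {v u k} → A u v ≡ false → k ≤ deg S A u → k ≤ deg (S ∖ v) A u
deg-∖-nonadj {S = S} {A} {v} {u} e h = ≤-trans h (count-mono {p = nb S A u} λ x m →
  ∧-intro (∖-intro {p = S} (proj₁ (∧-elim m)) λ { refl → true≢false (proj₂ (∧-elim {S x} m)) e }) (proj₂ (∧-elim {S x} m)))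

-- The new exempt vertices are `s′` and `t′`; a vertex outside the remaining set, typically `v`
-- itself, stands for an absent one. The bound four survives because a vertex outside `N₁` is not
-- adjacent to `v`.
delete : ∀ {n m} {S : VSet n} {A N s t v} → Solver n m → count S < suc m → Admissible S A N s t →
  S ∋ v → N ∋ v → ∀ s′ t′ →
  (S ∖ v ∋ s′ → S ∖ v ∋ t′ → A s′ t′ ≡ true) →
  (S ∖ v ∋ s′ → A v s′ ≡ true ⊎ N ∋ s′) → (S ∖ v ∋ t′ → A v t′ ≡ true ⊎ N ∋ t′) →
  (∀ {u} → S ∋ u → u ≢ v → u ≢ s′ → u ≢ t′ → 3 ≤ deg (S ∖ v) A u) →
  (∃ λ u → (S ∋ u) × (u ≢ v) × (u ≢ s′) × (u ≢ t′)) → Solution S A N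
delete {n} {S = S} {A} {N} {v = v} solve l ad sv nv s′ t′ pr sN tN d3 (o , so , ov , os , ot) =
  solution-extend {S₁ = S₁} {N₁ = N₁} (λ s → proj₁ (∖-elim {p = S} s)) dead new
    (solve (count-∖< {S = S} sv l) ad′)
  where
  open Admissible ad
  S₁ N₁ : VSet n
  S₁ = S ∖ v
  N₁ x = N x ∨ A v x
  dead : ∀ {u} → S ∋ u → S₁ ∌ u → N ∋ u
  dead s s₁ with ∖-out {p = S} s s₁
  ... | refl = nv
  new : ∀ {u} → S₁ ∋ u → N₁ ∋ u → (N ∋ u) ⊎ (∃ λ w → (S ∋ w) × (S₁ ∌ w) × (A u w ≡ true))
  new {u} s e with ∨-elim {N u} e
  ... | inj₁ e′ = inj₁ e′
  ... | inj₂ e′ = inj₂ (v , sv , ∖-self S v , trans (symA u v) e′)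
  cut : ∀ {u w} → S₁ ∋ u → S ∋ w → S₁ ∌ w → A u w ≡ true → N₁ ∋ u
  cut {u} s sw s₁ e with ∖-out {p = S} sw s₁
  ... | refl = ∨-introʳ {N u} (trans (symA v u) e)
  inN₁ : ∀ {u} → A v u ≡ true ⊎ N ∋ u → N₁ ∋ u
  inN₁ {u} (inj₁ e) = ∨-introʳ {N u} e
  inN₁     (inj₂ e) = ∨-introˡ e
  d4 : ∀ {u} → S₁ ∋ u → N₁ ∌ u → 4 ≤ deg S₁ A u
  d4 {u} s e = deg-∖-nonadj {S = S} {A}
    (¬true⇒false λ a → true≢false (∨-introʳ {N u} (trans (symA v u) a)) e)
    (deg≥4 (proj₁ (∖-elim {p = S} s)) (¬true⇒false λ a → true≢false (∨-introˡ a) e))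
  ad′ : Admissible S₁ A N₁ s′ t′
  ad′ = record
    { symA = symA ; irrA = irrA ; paired = pr ; s∈N = inN₁ ∘ sN ; t∈N = inN₁ ∘ tN
    ; deg≥3 = λ {u} s us ut → d3 (proj₁ (∖-elim {p = S} s)) (proj₂ (∖-elim {p = S} s)) us ut
    ; deg≥4 = d4
    ; reach = λ {u} s → restrict-reach (λ _ → ∨-introˡ) cut (proj₁ (∖-elim {p = S} s)) (reach (proj₁ (∖-elim {p = S} s))) s
    ; other = o , ∖-intro {p = S} so ov , os , ot }

-- Adding edges

addEdge : ∀ {n} → Adj n → Fin n → Fin n → Adj n
addEdge A u v x y = A x y ∨ (((x =ᶠ u) ∧ (y =ᶠ v)) ∨ ((x =ᶠ v) ∧ (y =ᶠ u)))

module _ {n} {A : Adj n} {u v : Fin n} where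

  addEdge-old : ∀ {x y} → A x y ≡ true → addEdge A u v x y ≡ true
  addEdge-old = ∨-introˡ

  addEdge-new : addEdge A u v u v ≡ true
  addEdge-new = ∨-introʳ {A u v} (∨-introˡ (∧-intro (≡⇒=ᶠ {i = u} refl) (≡⇒=ᶠ {i = v} refl)))

  addEdge-elim : ∀ {x y} → addEdge A u v x y ≡ true → A x y ≡ true ⊎ SameEdge x y u v
  addEdge-elim {x} {y} h with ∨-elim {A x y} h
  ... | inj₁ e = inj₁ e
  ... | inj₂ e with ∨-elim {(x =ᶠ u) ∧ (y =ᶠ v)} e
  ...   | inj₁ e′ = let (a , b) = ∧-elim {x =ᶠ u} e′ in inj₂ (inj₁ (=ᶠ⇒≡ a , =ᶠ⇒≡ b))
  ...   | inj₂ e′ = let (a , b) = ∧-elim {x =ᶠ v} e′ in inj₂ (inj₂ (=ᶠ⇒≡ a , =ᶠ⇒≡ b))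

  addEdge-new′ : addEdge A u v v u ≡ true
  addEdge-new′ = ∨-introʳ {A v u} (∨-introʳ {(v =ᶠ u) ∧ (u =ᶠ v)} (∧-intro (≡⇒=ᶠ {i = v} refl) (≡⇒=ᶠ {i = u} refl)))

  addEdge-symmetric : Symmetric A → Symmetric (addEdge A u v)
  addEdge-symmetric s x y = bool-ext (flip x y) (flip y x)
    where
    flip : ∀ x y → addEdge A u v x y ≡ true → addEdge A u v y x ≡ true
    flip x y h with addEdge-elim {x} {y} h
    ... | inj₁ e = addEdge-old {y} {x} (trans (s y x) e)
    ... | inj₂ (inj₁ (refl , refl)) = addEdge-new′
    ... | inj₂ (inj₂ (refl , refl)) = addEdge-new

  addEdge-irreflexive : Irreflexive A → u ≢ v → Irreflexive (addEdge A u v)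
  addEdge-irreflexive r ne x = ¬true⇒false bad
    where
    bad : addEdge A u v x x ≡ true → ⊥
    bad h with addEdge-elim {x} {x} h
    ... | inj₁ e = true≢false e (r x)
    ... | inj₂ (inj₁ (refl , e)) = ne e
    ... | inj₂ (inj₂ (refl , e)) = ne (≡-sym e)

-- The reason why suppression and contraction preserve degrees: the neighbour `v` that disappears is
-- traded for the new neighbour `w`.
deg-exchange : ∀ {n} {S : VSet n} {A A₁ : Adj n} {u v w} → S ∋ v → A u v ≡ true → S ∋ w → w ≢ v →
  A u w ≡ false → A₁ u w ≡ true → (∀ {x} → x ≢ w → S ∋ x → x ≢ v → A u x ≡ A₁ u x) →
  deg (S ∖ v) A₁ u ≡ deg S A u
deg-exchange {S = S} {A} {A₁} {u} {v} {w} sv uv sw wv uw uw₁ same =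
  count-exchange {p = nb S A u} {nb (S ∖ v) A₁ u} {v} {w} (∧-intro sv uv)
    (¬true⇒false λ e → true≢false (proj₂ (∧-elim {S w} e)) uw)
    (∧-intro (∖-intro {p = S} sw wv) uw₁) eq
  where
  eq : ∀ x → x ≢ w → nb (S ∖ v) A₁ u x ≡ (nb S A u ∖ v) x
  eq x xw = bool-ext to from
    where
    to : nb (S ∖ v) A₁ u x ≡ true → (nb S A u ∖ v) x ≡ true
    to h with ∧-elim {(S ∖ v) x} h
    ... | a , b with ∖-elim {p = S} {v} {x} a
    ...   | c , d = ∖-intro {p = nb S A u} (∧-intro c (trans (same xw c d) b)) d
    from : (nb S A u ∖ v) x ≡ true → nb (S ∖ v) A₁ u x ≡ true
    from h with ∖-elim {p = nb S A u} {v} {x} h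
    ... | a , d with ∧-elim {S x} a
    ...   | c , b = ∧-intro (∖-intro {p = S} c d) (trans (≡-sym (same xw c d)) b)

deg-∖-mono : ∀ {n} {S : VSet n} {A A₁ : Adj n} {u v} → A u v ≡ false →
  (∀ {x} → A u x ≡ true → A₁ u x ≡ true) → deg S A u ≤ deg (S ∖ v) A₁ u
deg-∖-mono {S = S} {A} {A₁} {u} {v} e le = count-mono {p = nb S A u} incl
  where
  incl : ∀ x → nb S A u ∋ x → nb (S ∖ v) A₁ u ∋ x
  incl x m with ∧-elim {S x} m
  ... | a , b = ∧-intro (∖-intro {p = S} a λ { refl → true≢false b e }) (le b)

-- Suppressing a vertex of degree two

-- Since `w` and `w′` are not adjacent, the added edge is new and each of them trades `s` for the
-- other. After that `s` is dead, and at most `t` stays exempt.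
suppress : ∀ {n m} {S : VSet n} {A N s t w w′} → Solver n m → count S < suc m → Admissible S A N s t →
  S ∋ s → S ∋ w → S ∋ w′ → w ≢ w′ → A s w ≡ true → A s w′ ≡ true → A w w′ ≡ false →
  (∀ {x} → S ∋ x → A s x ≡ true → (x ≡ w) ⊎ (x ≡ w′)) → Solution S A N
suppress {n} {S = S} {A} {N} {s} {t} {w} {w′} solve l ad ss sw sw′ ww′ aw aw′ nww only =
  lift (solve (count-∖< {S = S} ss l) ad′)
  where
  open Admissible ad
  S₁ N₁ : VSet n
  S₁ = S ∖ s
  N₁ x = N x ∨ A s x
  A₁ : Adj n
  A₁ = addEdge A w w′
  ns : N ∋ s
  ns = s∈N ss
  out-S : ∀ {x} → S₁ ∋ x → S ∋ x
  out-S h = proj₁ (∖-elim {p = S} h)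
  ≢s : ∀ {x} → S₁ ∋ x → x ≢ s
  ≢s h = proj₂ (∖-elim {p = S} h)
  w≢s : w ≢ s
  w≢s refl = true≢false aw (irrA w)
  w′≢s : w′ ≢ s
  w′≢s refl = true≢false aw′ (irrA w′)
  new⇒ : ∀ {x y} → A₁ x y ≡ true → A x y ≡ true ⊎ SameEdge x y w w′
  new⇒ {x} {y} = addEdge-elim {A = A} {w} {w′} {x} {y}
  degree-kept : ∀ {u} → S₁ ∋ u → deg S A u ≤ deg S₁ A₁ u
  degree-kept {u} su with u ≟ w | u ≟ w′
  ... | yes refl | _ = ≤-reflexive (≡-sym (deg-exchange {S = S} {A} {A₁} {w} {s} {w′} ss (trans (symA w s) aw) sw′ w′≢s nww
        (addEdge-new {A = A}) λ {x} xw′ _ _ → bool-ext (addEdge-old {A = A} {x = w} {x}) (back xw′)))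
    where
    back : ∀ {x} → x ≢ w′ → A₁ w x ≡ true → A w x ≡ true
    back {x} ne h with new⇒ {w} {x} h
    ... | inj₁ e = e
    ... | inj₂ (inj₁ (_ , e)) = ⊥-elim (ne e)
    ... | inj₂ (inj₂ (e , _)) = ⊥-elim (ww′ e)
  ... | no _ | yes refl = ≤-reflexive (≡-sym (deg-exchange {S = S} {A} {A₁} {w′} {s} {w} ss (trans (symA w′ s) aw′) sw w≢s
        (trans (symA w′ w) nww) (addEdge-new′ {A = A}) λ {x} xw _ _ → bool-ext (addEdge-old {A = A} {x = w′} {x}) (back xw)))
    where
    back : ∀ {x} → x ≢ w → A₁ w′ x ≡ true → A w′ x ≡ true
    back {x} ne h with new⇒ {w′} {x} h
    ... | inj₁ e = e
    ... | inj₂ (inj₁ (e , _)) = ⊥-elim (ww′ (≡-sym e))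
    ... | inj₂ (inj₂ (_ , e)) = ⊥-elim (ne e)
  ... | no uw | no uw′ = deg-∖-mono {S = S} {A} {A₁} {u} {s} (¬true⇒false far) (λ {x} → addEdge-old {A = A} {x = u} {x})
    where
    far : A u s ≡ true → ⊥
    far e with only (out-S su) (trans (symA s u) e)
    ... | inj₁ e′ = uw e′
    ... | inj₂ e′ = uw′ e′
  reach₁ : ∀ {u} → S ∋ u → Reach A (S ∋_) N u → S₁ ∋ u → Reach A₁ (S₁ ∋_) N₁ u
  reach₁ = reach-fold (λ u → S₁ ∋ u → Reach A₁ (S₁ ∋_) N₁ u) (λ _ e _ → stop (∨-introˡ e)) next
    where
    next : ∀ {u x} → S ∋ u → A u x ≡ true → S ∋ x → (S₁ ∋ x → Reach A₁ (S₁ ∋_) N₁ x) →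
      S₁ ∋ u → Reach A₁ (S₁ ∋_) N₁ u
    next {u} {x} _ e sx r su with bool (S₁ x)
    ... | inj₁ sx₁ = step (addEdge-old {A = A} {x = u} {x} e) sx₁ (r sx₁)
    ... | inj₂ sx₁ with ∖-out {p = S} sx sx₁
    ...   | refl = stop (∨-introʳ {N u} (trans (symA s u) e))
  ad′ : Admissible S₁ A₁ N₁ s t
  ad′ = record
    { symA = addEdge-symmetric symA ; irrA = addEdge-irreflexive {A = A} irrA ww′
    ; paired = λ s₁ _ → ⊥-elim (≢s s₁ refl)
    ; s∈N = λ s₁ → ⊥-elim (≢s s₁ refl) ; t∈N = λ t₁ → ∨-introˡ (t∈N (out-S t₁))
    ; deg≥3 = λ su us ut → ≤-trans (deg≥3 (out-S su) us ut) (degree-kept su)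
    ; deg≥4 = λ su nu → ≤-trans (deg≥4 (out-S su) (¬true⇒false λ e → true≢false (∨-introˡ e) nu)) (degree-kept su)
    ; reach = λ su → reach₁ (out-S su) (reach (out-S su)) su
    ; other = let (o , so , os , ot) = other in o , ∖-intro {p = S} so os , os , ot }
  lift : Solution S₁ A₁ N₁ → Solution S A N
  lift (mkSolution K K⊆ fam out) with bool (K w ∧ K w′)
  -- Here `K` does not contain the added edge. As `s` is in `N` and outside `K`, the vertices `w`
  -- and `w′` leave through it, and no path needs the added edge.
  ... | inj₂ k = mkSolution K (out-S ∘ K⊆) (fam-cong fam same) out′
    where
    not-both : K ∋ w → K ∋ w′ → ⊥
    not-both a b = true≢false (∧-intro a b) k
    same : ∀ {x y} → K ∋ x → K ∋ y → A x y ≡ A₁ x y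
    same {x} {y} kx ky = bool-ext (addEdge-old {A = A} {x = x} {y}) back
      where
      back : A₁ x y ≡ true → A x y ≡ true
      back h with new⇒ {x} {y} h
      ... | inj₁ e = e
      ... | inj₂ (inj₁ (refl , refl)) = ⊥-elim (not-both kx ky)
      ... | inj₂ (inj₂ (refl , refl)) = ⊥-elim (not-both ky kx)
    R : Fin n → Set
    R = Reach A (λ x → (S ∋ x) × (K ∌ x)) N
    ks : K ∌ s
    ks = ¬true⇒false λ e → ≢s (K⊆ e) refl
    via-s : ∀ {u} → A s u ≡ true → R u
    via-s {u} e = step (trans (symA u s) e) (ss , ks) (stop ns)
    halt : ∀ {u} → (S₁ ∋ u) × (K ∌ u) → N₁ ∋ u → R u
    halt {u} _ e with ∨-elim {N u} e
    ... | inj₁ e′ = stop e′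
    ... | inj₂ e′ = via-s e′
    next : ∀ {u x} → (S₁ ∋ u) × (K ∌ u) → A₁ u x ≡ true → (S₁ ∋ x) × (K ∌ x) → R x → R u
    next {u} {x} _ e (sx , kx) r with new⇒ {u} {x} e
    ... | inj₁ e′ = step e′ (out-S sx , kx) r
    ... | inj₂ (inj₁ (refl , _)) = via-s aw
    ... | inj₂ (inj₂ (refl , _)) = via-s aw′
    out′ : ∀ {u} → S ∋ u → K ∌ u → R u
    out′ {u} su ku with u ≟ s
    ... | yes refl = stop ns
    ... | no us = reach-fold R halt next (∖-intro {p = S} su us , ku) (out (∖-intro {p = S} su us) ku)
  -- An induced copy with both ends contains the added edge, and `s` subdivides it. Paths outside
  -- `K` then avoid both ends, so they survive unchanged.
  ... | inj₁ k = mkSolution (K ⊕ s) K⊆′ fam′ out′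
    where
    kw : K ∋ w
    kw = proj₁ (∧-elim k)
    kw′ : K ∋ w′
    kw′ = proj₂ (∧-elim {K w} k)
    ks : K ∌ s
    ks = ¬true⇒false λ e → ≢s (K⊆ e) refl
    K⊆′ : ∀ {x} → K ⊕ s ∋ x → S ∋ x
    K⊆′ h with ⊕-elim {p = K} h
    ... | inj₁ e = out-S (K⊆ e)
    ... | inj₂ refl = ss
    fam′ : Fam A (K ⊕ s)
    fam′ = fam-subdivide symA irrA fam kw kw′ ks (addEdge-new {A = A})
      (λ {x} {y} _ _ e → addEdge-old {A = A} {x = x} {y} e , not-new e)
      (λ {x} {y} _ _ e ne → back x y e ne) aw aw′ (λ kx → only (out-S (K⊆ kx)))
      where
      not-new : ∀ {x y} → A x y ≡ true → SameEdge x y w w′ → ⊥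
      not-new e (inj₁ (refl , refl)) = true≢false e nww
      not-new e (inj₂ (refl , refl)) = true≢false (trans (symA w w′) e) nww
      back : ∀ x y → A₁ x y ≡ true → ¬ SameEdge x y w w′ → A x y ≡ true
      back x y h ne with new⇒ {x} {y} h
      ... | inj₁ e = e
      ... | inj₂ e = ⊥-elim (ne e)
    R : Fin n → Set
    R = Reach A (λ x → (S ∋ x) × (K ⊕ s ∌ x)) N
    not-K : ∀ {x} → S₁ ∋ x → K ∌ x → K ⊕ s ∌ x
    not-K sx kx = ¬true⇒false λ h → bad (⊕-elim {p = K} h)
      where
      bad : _ → ⊥
      bad (inj₁ e) = true≢false e kx
      bad (inj₂ e) = ≢s sx e
    halt : ∀ {u} → (S₁ ∋ u) × (K ∌ u) → N₁ ∋ u → R u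
    halt {u} (su , ku) e with ∨-elim {N u} e
    ... | inj₁ e′ = stop e′
    ... | inj₂ e′ with only (out-S su) e′
    ...   | inj₁ refl = ⊥-elim (true≢false kw ku)
    ...   | inj₂ refl = ⊥-elim (true≢false kw′ ku)
    next : ∀ {u x} → (S₁ ∋ u) × (K ∌ u) → A₁ u x ≡ true → (S₁ ∋ x) × (K ∌ x) → R x → R u
    next {u} {x} (_ , ku) e (sx , kx) r with new⇒ {u} {x} e
    ... | inj₁ e′ = step e′ (out-S sx , not-K sx kx) r
    ... | inj₂ (inj₁ (refl , _)) = ⊥-elim (true≢false kw ku)
    ... | inj₂ (inj₂ (refl , _)) = ⊥-elim (true≢false kw′ ku)
    out′ : ∀ {u} → S ∋ u → K ⊕ s ∌ u → R u
    out′ {u} su ku with ⊕-out {p = K} ku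
    ... | ku′ , us = reach-fold R halt next (∖-intro {p = S} su us , ku′) (out (∖-intro {p = S} su us) ku′)

nb-elim : ∀ {n} {S : VSet n} {A : Adj n} {u x} → nb S A u ∋ x → (S ∋ x) × (A u x ≡ true)
nb-elim {S = S} {x = x} h = ∧-elim {S x} h

-- Exempt vertices of degree at most two

-- Serves to re-establish `other` when the exempt vertices change.
another-neighbour : ∀ {n} {S : VSet n} {A : Adj n} {w s z} → Irreflexive A → 3 ≤ deg S A w →
  ∃ λ u → (S ∋ u) × (u ≢ w) × (u ≢ s) × (u ≢ z)
another-neighbour {S = S} {A} {w} {s} {z} irr d
  with count>0 {p = nb S A w ∖ s ∖ z} (count-remove≥ (nb S A w ∖ s) z (count-remove≥ (nb S A w) s d))
... | u , h with ∖-elim {p = nb S A w ∖ s} {z} {u} h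
...   | h₁ , uz with ∖-elim {p = nb S A w} {s} {u} h₁
...     | h₂ , us with nb-elim {S = S} {A} {w} {u} h₂
...       | su , wu = u , su , (λ { refl → true≢false wu (irr u) }) , us , uz

-- A single neighbour, or two adjacent ones, take over the exemption; by `paired` a live `t` is
-- among them, so it is not forgotten. Two nonadjacent neighbours do not qualify, and `s` is
-- suppressed.
low-degree : ∀ {n m} {S : VSet n} {A N s t} → Solver n m → count S < suc m → Admissible S A N s t →
  S ∋ s → deg S A s ≤ 2 → Solution S A N
low-degree {n} {S = S} {A} {N} {s} {t} solve l ad ss d = cases (deg S A s) refl d
  where
  open Admissible ad
  s-dead : ∀ {X : Set} → S ∖ s ∋ s → X
  s-dead h = ⊥-elim (proj₂ (∖-elim {p = S} h) refl)
  cases : ∀ k → deg S A s ≡ k → k ≤ 2 → Solution S A N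
  cases zero e _ = delete solve l ad ss (s∈N ss) s t s-dead s-dead
    (λ st → inj₂ (t∈N (proj₁ (∖-elim {p = S} st))))
    (λ {u} su _ us ut → deg-∖-nonadj {S = S} {A}
      (¬true⇒false λ us′ → true≢false (∧-intro su (trans (symA s u) us′)) (count≡0 {p = nb S A s} e u))
      (deg≥3 su us ut))
    (let (o , so , os , ot) = other in o , so , os , os , ot)
  cases (suc zero) e _ with count-pick {p = nb S A s} e
  ... | w , sw , e₁ with nb-elim {S = S} {A} {s} {w} sw
  ...   | Sw , aw = delete solve l ad ss (s∈N ss) s w s-dead s-dead (λ _ → inj₁ aw)
      (λ {u} su us _ uw → deg-∖-nonadj {S = S} {A} (¬true⇒false λ us′ → uw (only (trans (symA s u) us′) su))
        (deg≥3 su us λ { refl → uw (only (paired ss su) su) }))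
      oth
    where
    only : ∀ {u} → A s u ≡ true → S ∋ u → u ≡ w
    only {u} a su = ∖-out {p = nb S A s} (∧-intro su a) (count≡0 {p = nb S A s ∖ w} e₁ u)
    oth : ∃ λ u → (S ∋ u) × (u ≢ s) × (u ≢ s) × (u ≢ w)
    oth with w ≟ t
    ... | yes refl = let (o , so , os , ot) = other in o , so , os , os , ot
    ... | no wt with another-neighbour {S = S} {A} {w} {s} {s} irrA
                       (deg≥3 Sw (λ { refl → true≢false aw (irrA w) }) wt)
    ...   | u , su , uw , us , _ = u , su , us , us , uw
  cases (suc (suc zero)) e _ with count-pick {p = nb S A s} e
  ... | w , sw , e₁ with count-pick {p = nb S A s ∖ w} e₁
  ...   | w′ , sw″ , e₂ with ∖-elim {p = nb S A s} {w} {w′} sw″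
  ...     | sw′ , w′w with nb-elim {S = S} {A} {s} {w} sw | nb-elim {S = S} {A} {s} {w′} sw′
  ...       | Sw , aw | Sw′ , aw′ = go (bool (A w w′))
    where
    only : ∀ {u} → S ∋ u → A s u ≡ true → (u ≡ w) ⊎ (u ≡ w′)
    only {u} su a with u ≟ w
    ... | yes uw = inj₁ uw
    ... | no uw = inj₂ (∖-out {p = nb S A s ∖ w} (∖-intro {p = nb S A s} (∧-intro su a) uw)
                         (count≡0 {p = nb S A s ∖ w ∖ w′} e₂ u))
    oth : ∃ λ u → (S ∋ u) × (u ≢ s) × (u ≢ w) × (u ≢ w′)
    oth with w ≟ t
    ... | no wt with another-neighbour {S = S} {A} {w} {s} {w′} irrA
                       (deg≥3 Sw (λ { refl → true≢false aw (irrA w) }) wt)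
    ...   | u , su , uw , us , uw′ = u , su , us , uw , uw′
    oth | yes refl with another-neighbour {S = S} {A} {w′} {s} {w} irrA
                          (deg≥3 Sw′ (λ { refl → true≢false aw′ (irrA w′) }) w′w)
    ...   | u , su , uw′ , us , uw = u , su , us , uw , uw′
    far : ∀ {u} → S ∋ u → u ≢ w → u ≢ w′ → A s u ≡ true → ⊥
    far su uw uw′ a with only su a
    ... | inj₁ h = uw h
    ... | inj₂ h = uw′ h
    go : (A w w′ ≡ true) ⊎ (A w w′ ≡ false) → Solution S A N
    go (inj₂ nww) = suppress solve l ad ss Sw Sw′ (w′w ∘ ≡-sym) aw aw′ nww only
    go (inj₁ ww) = delete solve l ad ss (s∈N ss) w w′ (λ _ _ → ww) (λ _ → inj₁ aw) (λ _ → inj₁ aw′)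
      (λ {u} su us uw uw′ → deg-∖-nonadj {S = S} {A} (¬true⇒false λ us′ → far su uw uw′ (trans (symA s u) us′))
        (deg≥3 su us λ { refl → far su uw uw′ (paired ss su) }))
      oth
  cases (suc (suc (suc _))) _ (s≤s (s≤s ()))

-- Contracting an edge between two vertices of degree three

-- The contracted vertex keeps the name `b`: `a` is removed and `b` is joined to `p` and `q`, while
-- `N` stays the same. As `ab` is in no triangle, the added edges are new, no other degree drops,
-- and `b` has the four distinct neighbours `p`, `q`, `r`, `r′`. Nobody is exempt afterwards, which
-- is expressed by the dead pair `a`, `a`.
module Contraction {n m} {S : VSet n} {A N s t} (solve : Solver n m) (l : count S < suc m)
  (ad : Admissible S A N s t) (all≥3 : ∀ {u} → S ∋ u → 3 ≤ deg S A u)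
  {a b p q r r′ : Fin n} (sa : S ∋ a) (sb : S ∋ b) (na : N ∋ a) (nbb : N ∋ b)
  (ta : Three (nb S A a) b p q) (tb : Three (nb S A b) a r r′)
  (bp : A b p ≡ false) (bq : A b q ≡ false) where

  open Admissible ad
  private
    module TA = Three ta
    module TB = Three tb
    S₁ : VSet n
    S₁ = S ∖ a
    A₁ : Adj n
    A₁ = addEdge (addEdge A b p) b q
    out-S : ∀ {x} → S₁ ∋ x → S ∋ x
    out-S h = proj₁ (∖-elim {p = S} h)
    ≢a : ∀ {x} → S₁ ∋ x → x ≢ a
    ≢a h = proj₂ (∖-elim {p = S} h)
    el : ∀ {u x} → nb S A u ∋ x → (S ∋ x) × (A u x ≡ true)
    el {u} {x} = nb-elim {S = S} {A} {u} {x}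
    ab : A a b ≡ true
    ab = proj₂ (el TA.in₁)
    sp : S ∋ p
    sp = proj₁ (el TA.in₂)
    ap : A a p ≡ true
    ap = proj₂ (el TA.in₂)
    aq : A a q ≡ true
    aq = proj₂ (el TA.in₃)
    ba : A b a ≡ true
    ba = proj₂ (el TB.in₁)
    br : A b r ≡ true
    br = proj₂ (el TB.in₂)
    br′ : A b r′ ≡ true
    br′ = proj₂ (el TB.in₃)
    differ : ∀ {x y z} → A x y ≡ true → A x z ≡ false → z ≢ y
    differ e f refl = true≢false e f
    loop : ∀ {x y} → A x y ≡ true → y ≢ x
    loop {x} e refl = true≢false e (irrA x)
    b≢a : b ≢ a
    b≢a = loop ab
    p≢a : p ≢ a
    p≢a = loop ap
    old : ∀ {x y} → A x y ≡ true → A₁ x y ≡ true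
    old {x} {y} e = addEdge-old {A = addEdge A b p} {b} {q} {x} {y} (addEdge-old {A = A} {b} {p} {x} {y} e)
    new⇒ : ∀ {x y} → A₁ x y ≡ true → A x y ≡ true ⊎ SameEdge x y b p ⊎ SameEdge x y b q
    new⇒ {x} {y} h with addEdge-elim {A = addEdge A b p} {b} {q} {x} {y} h
    ... | inj₂ e = inj₂ (inj₂ e)
    ... | inj₁ e with addEdge-elim {A = A} {b} {p} {x} {y} e
    ...   | inj₁ e′ = inj₁ e′
    ...   | inj₂ e′ = inj₂ (inj₁ e′)
    sym₁ : Symmetric A₁
    sym₁ = addEdge-symmetric {A = addEdge A b p} (addEdge-symmetric {A = A} symA)
    irr₁ : Irreflexive A₁
    irr₁ = addEdge-irreflexive {A = addEdge A b p} (addEdge-irreflexive {A = A} irrA TA.a≢b) TA.a≢c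
    new-bp : A₁ b p ≡ true
    new-bp = addEdge-old {A = addEdge A b p} {b} {q} {b} {p} (addEdge-new {A = A})
    new-bq : A₁ b q ≡ true
    new-bq = addEdge-new {A = addEdge A b p}
    not-bp : ∀ {x y} → A x y ≡ true → SameEdge x y b p → ⊥
    not-bp e (inj₁ (refl , refl)) = true≢false e bp
    not-bp e (inj₂ (refl , refl)) = true≢false (trans (symA b p) e) bp
    not-bq : ∀ {x y} → A x y ≡ true → SameEdge x y b q → ⊥
    not-bq e (inj₁ (refl , refl)) = true≢false e bq
    not-bq e (inj₂ (refl , refl)) = true≢false (trans (symA b q) e) bq
    only-a : ∀ {x} → S ∋ x → A a x ≡ true → (x ≡ b) ⊎ (x ≡ p) ⊎ (x ≡ q)
    only-a sx e = TA.all (∧-intro sx e)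
    only-b : ∀ {x} → S ∋ x → A b x ≡ true → (x ≡ a) ⊎ (x ≡ r) ⊎ (x ≡ r′)
    only-b sx e = TB.all (∧-intro sx e)

    -- Trading `a` for `p` already gives three, and three is enough because `b` lies in `N`.
    degree-b : 3 ≤ deg S₁ A₁ b
    degree-b = ≤-trans (all≥3 sb) (≤-trans (≤-reflexive (≡-sym
        (deg-exchange {S = S} {A} {addEdge A b p} {b} {a} {p} sa ba sp p≢a bp (addEdge-new {A = A})
          λ {x} xp _ _ → bool-ext (addEdge-old {A = A} {b} {p} {b} {x}) (back xp))))
        (count-mono {p = nb S₁ (addEdge A b p) b} λ x h → let (i , j) = ∧-elim {S₁ x} h in
          ∧-intro i (addEdge-old {A = addEdge A b p} {b} {q} {b} {x} j)))
      where
      back : ∀ {x} → x ≢ p → addEdge A b p b x ≡ true → A b x ≡ true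
      back {x} ne h with addEdge-elim {A = A} {b} {p} {b} {x} h
      ... | inj₁ e = e
      ... | inj₂ (inj₁ (_ , e)) = ⊥-elim (ne e)
      ... | inj₂ (inj₂ (e , _)) = ⊥-elim (TA.a≢b e)

    degree-kept : ∀ {u} → S₁ ∋ u → u ≢ b → deg S A u ≤ deg S₁ A₁ u
    degree-kept {u} su ub with u ≟ p | u ≟ q
    ... | yes refl | _ = ≤-reflexive (≡-sym (deg-exchange {S = S} {A} {A₁} {p} {a} {b} sa (trans (symA p a) ap) sb b≢a
          (trans (symA p b) bp) (trans (sym₁ p b) new-bp)
          λ {x} xb _ _ → bool-ext (old {p} {x}) (back xb)))
      where
      back : ∀ {x} → x ≢ b → A₁ p x ≡ true → A p x ≡ true
      back {x} ne h with new⇒ {p} {x} h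
      ... | inj₁ e = e
      ... | inj₂ (inj₁ (inj₁ (e , _))) = ⊥-elim (ub e)
      ... | inj₂ (inj₁ (inj₂ (_ , e))) = ⊥-elim (ne e)
      ... | inj₂ (inj₂ (inj₁ (e , _))) = ⊥-elim (ub e)
      ... | inj₂ (inj₂ (inj₂ (_ , e))) = ⊥-elim (ne e)
    ... | no _ | yes refl = ≤-reflexive (≡-sym (deg-exchange {S = S} {A} {A₁} {q} {a} {b} sa (trans (symA q a) aq) sb b≢a
          (trans (symA q b) bq) (trans (sym₁ q b) new-bq)
          λ {x} xb _ _ → bool-ext (old {q} {x}) (back xb)))
      where
      back : ∀ {x} → x ≢ b → A₁ q x ≡ true → A q x ≡ true
      back {x} ne h with new⇒ {q} {x} h
      ... | inj₁ e = e
      ... | inj₂ (inj₁ (inj₁ (e , _))) = ⊥-elim (ub e)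
      ... | inj₂ (inj₁ (inj₂ (_ , e))) = ⊥-elim (ne e)
      ... | inj₂ (inj₂ (inj₁ (e , _))) = ⊥-elim (ub e)
      ... | inj₂ (inj₂ (inj₂ (_ , e))) = ⊥-elim (ne e)
    ... | no up | no uq = deg-∖-mono {S = S} {A} {A₁} {u} {a} (¬true⇒false far) (λ {x} → old {u} {x})
      where
      far : A u a ≡ true → ⊥
      far e with only-a (out-S su) (trans (symA a u) e)
      ... | inj₁ h = ub h
      ... | inj₂ (inj₁ h) = up h
      ... | inj₂ (inj₂ h) = uq h

    s₁b : S₁ ∋ b
    s₁b = ∖-intro {p = S} sb b≢a

    -- A path enters `a` from `b`, `p` or `q`. There it can end in `b`, which is in `N` and now
    -- adjacent to `p` and `q`.
    reach₁ : ∀ {u} → S ∋ u → Reach A (S ∋_) N u → S₁ ∋ u → Reach A₁ (S₁ ∋_) N u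
    reach₁ = reach-fold (λ u → S₁ ∋ u → Reach A₁ (S₁ ∋_) N u) (λ _ e _ → stop e) next
      where
      next : ∀ {u x} → S ∋ u → A u x ≡ true → S ∋ x → (S₁ ∋ x → Reach A₁ (S₁ ∋_) N x) →
        S₁ ∋ u → Reach A₁ (S₁ ∋_) N u
      next {u} {x} su′ e sx rx su with bool (S₁ x)
      ... | inj₁ sx₁ = step (old {u} {x} e) sx₁ (rx sx₁)
      ... | inj₂ sx₁ with ∖-out {p = S} sx sx₁
      ...   | refl with only-a su′ (trans (symA a u) e)
      ...     | inj₁ refl = stop nbb
      ...     | inj₂ (inj₁ refl) = step (trans (sym₁ p b) new-bp) s₁b (stop nbb)
      ...     | inj₂ (inj₂ refl) = step (trans (sym₁ q b) new-bq) s₁b (stop nbb)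

    admissible₁ : Admissible S₁ A₁ N a a
    admissible₁ = record
      { symA = sym₁ ; irrA = irr₁
      ; paired = λ h → ⊥-elim (≢a h refl) ; s∈N = λ h → ⊥-elim (≢a h refl) ; t∈N = λ h → ⊥-elim (≢a h refl)
      ; deg≥3 = λ {u} su _ _ → d3 su (u ≟ b)
      ; deg≥4 = λ {u} su nu → ≤-trans (deg≥4 (out-S su) nu)
          (degree-kept su λ { refl → true≢false nbb nu })
      ; reach = λ su → reach₁ (out-S su) (reach (out-S su)) su
      ; other = b , s₁b , b≢a , b≢a }
      where
      d3 : ∀ {u} → S₁ ∋ u → Dec (u ≡ b) → 3 ≤ deg S₁ A₁ u
      d3 su (yes refl) = degree-b
      d3 su (no ub) = ≤-trans (all≥3 (out-S su)) (degree-kept su ub)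

    module Lift (K : VSet n) (K⊆ : ∀ {x} → K ∋ x → S₁ ∋ x) (fam : Fam A₁ K)
      (out : ∀ {u} → S₁ ∋ u → K ∌ u → Reach A₁ (λ w → (S₁ ∋ w) × (K ∌ w)) N u) where

      K⊆S : ∀ {x} → K ∋ x → S ∋ x
      K⊆S k = out-S (K⊆ k)
      ka : K ∌ a
      ka = ¬true⇒false λ k → ≢a (K⊆ k) refl

      -- `K′` differs from `K` at most in `a` and `b`. Both lie in `N`, so either one is an exit
      -- when it is outside `K′`. The only steps lost are those between `b` and `p` or `q`; from `p`
      -- or `q` one steps to `a` instead, which is free by `into-a`.
      finish : (K′ : VSet n) → (∀ {x} → K′ ∋ x → (K ∋ x) ⊎ (x ≡ a) ⊎ (x ≡ b × K ∋ b)) →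
        (K′ ∋ a → K ∋ b) → (∀ {x} → K ∋ x → x ≢ b → K′ ∋ x) → Fam A K′ → Solution S A N
      finish K′ from into-a keep fam′ = mkSolution K′ K′⊆S fam′ out′
        where
        K′⊆S : ∀ {x} → K′ ∋ x → S ∋ x
        K′⊆S k with from k
        ... | inj₁ k′ = K⊆S k′
        ... | inj₂ (inj₁ refl) = sa
        ... | inj₂ (inj₂ (refl , _)) = sb
        R : Fin n → Set
        R = Reach A (λ x → (S ∋ x) × (K′ ∌ x)) N
        avoid : ∀ {x} → S₁ ∋ x → K ∌ x → K′ ∌ x
        avoid {x} sx kx = ¬true⇒false λ k → bad (from k)
          where
          bad : (K ∋ x) ⊎ (x ≡ a) ⊎ (x ≡ b × K ∋ b) → ⊥
          bad (inj₁ k) = true≢false k kx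
          bad (inj₂ (inj₁ e)) = ≢a sx e
          bad (inj₂ (inj₂ (refl , k))) = true≢false k kx
        via-a : ∀ {u} → K ∌ b → A u a ≡ true → R u
        via-a kb e = step e (sa , ¬true⇒false λ k → true≢false (into-a k) kb) (stop na)
        next : ∀ {u x} → (S₁ ∋ u) × (K ∌ u) → A₁ u x ≡ true → (S₁ ∋ x) × (K ∌ x) → R x → R u
        next {u} {x} _ e (sx , kx) rx with new⇒ {u} {x} e
        ... | inj₁ e′ = step e′ (out-S sx , avoid sx kx) rx
        ... | inj₂ (inj₁ (inj₁ (refl , _))) = stop nbb
        ... | inj₂ (inj₂ (inj₁ (refl , _))) = stop nbb
        ... | inj₂ (inj₁ (inj₂ (refl , refl))) = via-a kx (trans (symA p a) ap)
        ... | inj₂ (inj₂ (inj₂ (refl , refl))) = via-a kx (trans (symA q a) aq)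
        out′ : ∀ {u} → S ∋ u → K′ ∌ u → R u
        out′ {u} su ku with u ≟ a | u ≟ b
        ... | yes refl | _ = stop na
        ... | no _ | yes refl = stop nbb
        ... | no ua | no ub = reach-fold R (λ _ → stop) next (su₁ , ku₁) (out su₁ ku₁)
          where
          su₁ : S₁ ∋ u
          su₁ = ∖-intro {p = S} su ua
          ku₁ : K ∌ u
          ku₁ = ¬true⇒false λ k → true≢false (keep k ub) ku

      finish-same : (∀ {x y} → K ∋ x → K ∋ y → SameEdge x y b p → ⊥) →
        (∀ {x y} → K ∋ x → K ∋ y → SameEdge x y b q → ⊥) → Solution S A N
      finish-same np nq = finish K inj₁ (λ k → ⊥-elim (true≢false k ka)) (λ k _ → k)
        (fam-cong fam λ {x} {y} kx ky → bool-ext (old {x} {y}) (back kx ky))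
        where
        back : ∀ {x y} → K ∋ x → K ∋ y → A₁ x y ≡ true → A x y ≡ true
        back {x} {y} kx ky e with new⇒ {x} {y} e
        ... | inj₁ e′ = e′
        ... | inj₂ (inj₁ e′) = ⊥-elim (np kx ky e′)
        ... | inj₂ (inj₂ e′) = ⊥-elim (nq kx ky e′)

      finish-plus : K ∋ b → Fam A (K ⊕ a) → Solution S A N
      finish-plus kb = finish (K ⊕ a) from (λ _ → kb) (λ k _ → ⊕-old {p = K} k)
        where
        from : ∀ {x} → K ⊕ a ∋ x → (K ∋ x) ⊎ (x ≡ a) ⊎ (x ≡ b × K ∋ b)
        from k with ⊕-elim {p = K} k
        ... | inj₁ k′ = inj₁ k′
        ... | inj₂ e = inj₂ (inj₁ e)

      finish-p : K ∋ b → K ∋ p → K ∌ q → Solution S A N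
      finish-p kb kp kq = finish-plus kb (fam-subdivide symA irrA fam kb kp ka new-bp
        (λ {x} {y} _ _ e → old {x} {y} e , not-bp e) back ab ap only)
        where
        back : ∀ {x y} → K ∋ x → K ∋ y → A₁ x y ≡ true → ¬ SameEdge x y b p → A x y ≡ true
        back {x} {y} kx ky e ne with new⇒ {x} {y} e
        ... | inj₁ e′ = e′
        ... | inj₂ (inj₁ e′) = ⊥-elim (ne e′)
        ... | inj₂ (inj₂ (inj₁ (_ , refl))) = ⊥-elim (true≢false ky kq)
        ... | inj₂ (inj₂ (inj₂ (refl , _))) = ⊥-elim (true≢false kx kq)
        only : ∀ {x} → K ∋ x → A a x ≡ true → (x ≡ b) ⊎ (x ≡ p)
        only kx e with only-a (K⊆S kx) e
        ... | inj₁ h = inj₁ h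
        ... | inj₂ (inj₁ h) = inj₂ h
        ... | inj₂ (inj₂ refl) = ⊥-elim (true≢false kx kq)

      finish-q : K ∋ b → K ∌ p → K ∋ q → Solution S A N
      finish-q kb kp kq = finish-plus kb (fam-subdivide symA irrA fam kb kq ka new-bq
        (λ {x} {y} _ _ e → old {x} {y} e , not-bq e) back ab aq only)
        where
        back : ∀ {x y} → K ∋ x → K ∋ y → A₁ x y ≡ true → ¬ SameEdge x y b q → A x y ≡ true
        back {x} {y} kx ky e ne with new⇒ {x} {y} e
        ... | inj₁ e′ = e′
        ... | inj₂ (inj₂ e′) = ⊥-elim (ne e′)
        ... | inj₂ (inj₁ (inj₁ (_ , refl))) = ⊥-elim (true≢false ky kp)
        ... | inj₂ (inj₁ (inj₂ (refl , _))) = ⊥-elim (true≢false kx kp)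
        only : ∀ {x} → K ∋ x → A a x ≡ true → (x ≡ b) ⊎ (x ≡ q)
        only kx e with only-a (K⊆S kx) e
        ... | inj₁ h = inj₁ h
        ... | inj₂ (inj₂ h) = inj₂ h
        ... | inj₂ (inj₁ refl) = ⊥-elim (true≢false kx kp)

      -- The copy uses both added edges, so `a` must enter it. The rest depends on how many of `r`,
      -- `r′` are in `K`. If none, `a` simply replaces `b`, which gives `K₂`. If one, `b` returns
      -- and subdivides the edge from `a` to that vertex. If both, `b` has degree four in the copy
      -- and must be split.
      module Both (kb : K ∋ b) (kp : K ∋ p) (kq : K ∋ q) where

        K₂ : VSet n
        K₂ = K ∖ b ⊕ a
        to-a : Fin n → Fin n
        to-a x with x ≟ b
        ... | yes _ = a
        ... | no _  = x
        to-b : Fin n → Fin n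
        to-b x with x ≟ a
        ... | yes _ = b
        ... | no _  = x
        to-b-to-a : ∀ {x} → K ∋ x → to-b (to-a x) ≡ x
        to-b-to-a {x} kx with x ≟ b
        to-b-to-a {x} kx | yes refl with a ≟ a
        ... | yes _ = refl
        ... | no ne = ⊥-elim (ne refl)
        to-b-to-a {x} kx | no _ with x ≟ a
        ... | yes refl = ⊥-elim (true≢false kx ka)
        ... | no _ = refl
        to-b-a : to-b a ≡ b
        to-b-a with a ≟ a
        ... | yes _ = refl
        ... | no ne = ⊥-elim (ne refl)
        to-b-other : ∀ {x} → K ∋ x → to-b x ≡ x
        to-b-other {x} kx with x ≟ a
        ... | yes refl = ⊥-elim (true≢false kx ka)
        ... | no _ = refl
        A₂ : Adj n
        A₂ x y = A₁ (to-b x) (to-b y)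
        K₂-elim : ∀ {x} → K₂ ∋ x → ((K ∋ x) × (x ≢ b)) ⊎ (x ≡ a)
        K₂-elim {x} k with ⊕-elim {p = K ∖ b} {a} {x} k
        ... | inj₁ k′ = inj₁ (∖-elim {p = K} {b} {x} k′)
        ... | inj₂ e = inj₂ e
        K₂-intro : ∀ {x} → K ∋ x → x ≢ b → K₂ ∋ x
        K₂-intro kx ne = ⊕-old {p = K ∖ b} (∖-intro {p = K} kx ne)
        K₂∌b : K₂ ∌ b
        K₂∌b = ¬true⇒false λ k → bad (K₂-elim k)
          where
          bad : ((K ∋ b) × (b ≢ b)) ⊎ (b ≡ a) → ⊥
          bad (inj₁ (_ , ne)) = ne refl
          bad (inj₂ e) = b≢a e
        fam₂ : Fam A₂ K₂
        fam₂ = fam-map fam to-a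
          (λ kx ky e → trans (≡-sym (to-b-to-a kx)) (trans (cong to-b e) (to-b-to-a ky)))
          cov into
          (λ kx ky → cong₂ A₁ (to-b-to-a kx) (to-b-to-a ky))
          where
          cov : ∀ {v} → K₂ ∋ v → ∃ λ i → (K ∋ i) × (to-a i ≡ v)
          cov {v} k with K₂-elim k
          ... | inj₁ (kv , vb) = v , kv , same
            where
            same : to-a v ≡ v
            same with v ≟ b
            ... | yes e = ⊥-elim (vb e)
            ... | no _ = refl
          ... | inj₂ refl = b , kb , same
            where
            same : to-a b ≡ a
            same with b ≟ b
            ... | yes _ = refl
            ... | no ne = ⊥-elim (ne refl)
          into : ∀ {i} → K ∋ i → K₂ ∋ to-a i
          into {i} ki with i ≟ b
          ... | yes _ = ⊕-new (K ∖ b) a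
          ... | no ne = K₂-intro ki ne

        around-b : ∀ {y} → K ∋ y → A₁ b y ≡ true → (y ≡ r) ⊎ (y ≡ r′) ⊎ (A a y ≡ true)
        around-b {y} ky e with new⇒ {b} {y} e
        ... | inj₂ (inj₁ (inj₁ (_ , refl))) = inj₂ (inj₂ ap)
        ... | inj₂ (inj₂ (inj₁ (_ , refl))) = inj₂ (inj₂ aq)
        ... | inj₂ (inj₁ (inj₂ (h , _))) = ⊥-elim (TA.a≢b h)
        ... | inj₂ (inj₂ (inj₂ (h , _))) = ⊥-elim (TA.a≢c h)
        ... | inj₁ e′ with only-b (K⊆S ky) e′
        ...   | inj₁ refl = ⊥-elim (true≢false ky ka)
        ...   | inj₂ (inj₁ h) = inj₁ h
        ...   | inj₂ (inj₂ h) = inj₂ (inj₁ h)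

        from-a : ∀ {y} → K ∋ y → y ≢ b → A a y ≡ true → A₁ b y ≡ true
        from-a ky yb e with only-a (K⊆S ky) e
        ... | inj₁ h = ⊥-elim (yb h)
        ... | inj₂ (inj₁ refl) = new-bp
        ... | inj₂ (inj₂ refl) = new-bq

        to₂ : ∀ {x y} → K₂ ∋ x → K₂ ∋ y → A x y ≡ true → A₂ x y ≡ true
        to₂ {x} {y} kx ky e with K₂-elim kx | K₂-elim ky
        ... | inj₁ (kx′ , _) | inj₁ (ky′ , _) rewrite to-b-other kx′ | to-b-other ky′ = old {x} {y} e
        ... | inj₂ refl | inj₂ refl = ⊥-elim (true≢false e (irrA a))
        ... | inj₂ refl | inj₁ (ky′ , yb) rewrite to-b-a | to-b-other ky′ = from-a ky′ yb e
        ... | inj₁ (kx′ , xb) | inj₂ refl rewrite to-b-a | to-b-other kx′ =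
          trans (sym₁ x b) (from-a kx′ xb (trans (symA a x) e))

        from₂ : ∀ {x y} → K₂ ∋ x → K₂ ∋ y → A₂ x y ≡ true →
          (A x y ≡ true) ⊎ (SameEdge x y a r × K ∋ r) ⊎ (SameEdge x y a r′ × K ∋ r′)
        from₂ {x} {y} kx ky e with K₂-elim kx | K₂-elim ky
        from₂ {x} {y} kx ky e | inj₁ (kx′ , xb) | inj₁ (ky′ , yb)
          rewrite to-b-other kx′ | to-b-other ky′ with new⇒ {x} {y} e
        ... | inj₁ e′ = inj₁ e′
        ... | inj₂ (inj₁ (inj₁ (h , _))) = ⊥-elim (xb h)
        ... | inj₂ (inj₁ (inj₂ (_ , h))) = ⊥-elim (yb h)
        ... | inj₂ (inj₂ (inj₁ (h , _))) = ⊥-elim (xb h)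
        ... | inj₂ (inj₂ (inj₂ (_ , h))) = ⊥-elim (yb h)
        from₂ {x} {y} kx ky e | inj₂ refl | inj₂ refl rewrite to-b-a = ⊥-elim (true≢false e (irr₁ b))
        from₂ {x} {y} kx ky e | inj₂ refl | inj₁ (ky′ , yb)
          rewrite to-b-a | to-b-other ky′ with around-b ky′ e
        ... | inj₁ refl = inj₂ (inj₁ (inj₁ (refl , refl) , ky′))
        ... | inj₂ (inj₁ refl) = inj₂ (inj₂ (inj₁ (refl , refl) , ky′))
        ... | inj₂ (inj₂ e′) = inj₁ e′
        from₂ {x} {y} kx ky e | inj₁ (kx′ , xb) | inj₂ refl
          rewrite to-b-a | to-b-other kx′ with around-b kx′ (trans (sym₁ b x) e)
        ... | inj₁ refl = inj₂ (inj₁ (inj₂ (refl , refl) , kx′))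
        ... | inj₂ (inj₁ refl) = inj₂ (inj₂ (inj₂ (refl , refl) , kx′))
        ... | inj₂ (inj₂ e′) = inj₁ (trans (symA x a) e′)

        not-common : ∀ {z} → A b z ≡ true → S ∋ z → A a z ≡ true → ⊥
        not-common bz sz e with only-a sz e
        ... | inj₁ refl = true≢false bz (irrA b)
        ... | inj₂ (inj₁ refl) = true≢false bz bp
        ... | inj₂ (inj₂ refl) = true≢false bz bq

        finish-none : K ∌ r → K ∌ r′ → Solution S A N
        finish-none kr kr′ = finish K₂ from (λ _ → kb) K₂-intro
          (fam-cong fam₂ λ {x} {y} kx ky → bool-ext (to₂ kx ky) (back kx ky))
          where
          from : ∀ {x} → K₂ ∋ x → (K ∋ x) ⊎ (x ≡ a) ⊎ (x ≡ b × K ∋ b)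
          from k with K₂-elim k
          ... | inj₁ (k′ , _) = inj₁ k′
          ... | inj₂ e = inj₂ (inj₁ e)
          back : ∀ {x y} → K₂ ∋ x → K₂ ∋ y → A₂ x y ≡ true → A x y ≡ true
          back kx ky e with from₂ kx ky e
          ... | inj₁ e′ = e′
          ... | inj₂ (inj₁ (_ , k)) = ⊥-elim (true≢false k kr)
          ... | inj₂ (inj₂ (_ , k)) = ⊥-elim (true≢false k kr′)

        finish-one : ∀ {z} → K ∋ z → A b z ≡ true →
          (∀ {x} → K ∋ x → A b x ≡ true → x ≡ z) →
          (∀ {x y} → K₂ ∋ x → K₂ ∋ y → A₂ x y ≡ true → ¬ SameEdge x y a z → A x y ≡ true) →
          Solution S A N
        finish-one {z} kz bz only back = finish (K₂ ⊕ b) from (λ _ → kb)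
          (λ k ne → ⊕-old {p = K₂} (K₂-intro k ne))
          (fam-subdivide symA irrA fam₂ (⊕-new (K ∖ b) a) (K₂-intro kz zb) K₂∌b az
            (λ {x} {y} kx ky e → to₂ kx ky e , not-az e) back ba bz only′)
          where
          zb : z ≢ b
          zb = loop bz
          az : A₂ a z ≡ true
          az rewrite to-b-a | to-b-other kz = old {b} {z} bz
          not-az : ∀ {x y} → A x y ≡ true → SameEdge x y a z → ⊥
          not-az e (inj₁ (refl , refl)) = not-common bz (K⊆S kz) e
          not-az e (inj₂ (refl , refl)) = not-common bz (K⊆S kz) (trans (symA a z) e)
          only′ : ∀ {x} → K₂ ∋ x → A b x ≡ true → (x ≡ a) ⊎ (x ≡ z)
          only′ k e with K₂-elim k
          ... | inj₁ (k′ , _) = inj₂ (only k′ e)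
          ... | inj₂ h = inj₁ h
          from : ∀ {x} → K₂ ⊕ b ∋ x → (K ∋ x) ⊎ (x ≡ a) ⊎ (x ≡ b × K ∋ b)
          from {x} k with ⊕-elim {p = K₂} {b} {x} k
          ... | inj₂ e = inj₂ (inj₂ (e , kb))
          ... | inj₁ k′ with K₂-elim k′
          ...   | inj₁ (k″ , _) = inj₁ k″
          ...   | inj₂ e = inj₂ (inj₁ e)

        finish-r : K ∋ r → K ∌ r′ → Solution S A N
        finish-r kr kr′ = finish-one kr br only back
          where
          only : ∀ {x} → K ∋ x → A b x ≡ true → x ≡ r
          only kx e with only-b (K⊆S kx) e
          ... | inj₁ refl = ⊥-elim (true≢false kx ka)
          ... | inj₂ (inj₁ h) = h
          ... | inj₂ (inj₂ refl) = ⊥-elim (true≢false kx kr′)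
          back : ∀ {x y} → K₂ ∋ x → K₂ ∋ y → A₂ x y ≡ true → ¬ SameEdge x y a r → A x y ≡ true
          back kx ky e ne with from₂ kx ky e
          ... | inj₁ e′ = e′
          ... | inj₂ (inj₁ (h , _)) = ⊥-elim (ne h)
          ... | inj₂ (inj₂ (_ , k)) = ⊥-elim (true≢false k kr′)

        finish-r′ : K ∌ r → K ∋ r′ → Solution S A N
        finish-r′ kr kr′ = finish-one kr′ br′ only back
          where
          only : ∀ {x} → K ∋ x → A b x ≡ true → x ≡ r′
          only kx e with only-b (K⊆S kx) e
          ... | inj₁ refl = ⊥-elim (true≢false kx ka)
          ... | inj₂ (inj₁ refl) = ⊥-elim (true≢false kx kr)
          ... | inj₂ (inj₂ h) = h
          back : ∀ {x y} → K₂ ∋ x → K₂ ∋ y → A₂ x y ≡ true → ¬ SameEdge x y a r′ → A x y ≡ true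
          back kx ky e ne with from₂ kx ky e
          ... | inj₁ e′ = e′
          ... | inj₂ (inj₁ (_ , k)) = ⊥-elim (true≢false k kr)
          ... | inj₂ (inj₂ (h , _)) = ⊥-elim (ne h)

        -- `a` takes `p` and `q`, and `b` keeps `r` and `r′`. The two pairs are disjoint because `b`
        -- is adjacent in `A` to `r` and `r′` but not to `p` or `q`.
        finish-split : K ∋ r → K ∋ r′ → Solution S A N
        finish-split kr kr′ = finish-plus kb (fam-split symA irrA fam kb kp kq kr kr′ ka
          (TA.b≢c , differ br bp , differ br′ bp , differ br bq , differ br′ bq , TB.b≢c)
          new-bp new-bq (old {b} {r} br) (old {b} {r′} br′) only
          (λ {x} {y} _ _ e → old {x} {y} e , not-bp e , not-bq e) back ab ap aq
          (λ kx → only-a (K⊆S kx)))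
          where
          only : ∀ {x} → K ∋ x → A₁ b x ≡ true → (x ≡ p) ⊎ (x ≡ q) ⊎ (x ≡ r) ⊎ (x ≡ r′)
          only kx e with around-b kx e
          ... | inj₁ h = inj₂ (inj₂ (inj₁ h))
          ... | inj₂ (inj₁ h) = inj₂ (inj₂ (inj₂ h))
          ... | inj₂ (inj₂ e′) with only-a (K⊆S kx) e′
          ...   | inj₁ refl = ⊥-elim (true≢false e (irr₁ b))
          ...   | inj₂ (inj₁ h) = inj₁ h
          ...   | inj₂ (inj₂ h) = inj₂ (inj₁ h)
          back : ∀ {x y} → K ∋ x → K ∋ y → A₁ x y ≡ true → ¬ SameEdge x y b p → ¬ SameEdge x y b q → A x y ≡ true
          back {x} {y} _ _ e np nq with new⇒ {x} {y} e
          ... | inj₁ e′ = e′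
          ... | inj₂ (inj₁ h) = ⊥-elim (np h)
          ... | inj₂ (inj₂ h) = ⊥-elim (nq h)

        both : Solution S A N
        both with bool (K r) | bool (K r′)
        ... | inj₁ kr | inj₁ kr′ = finish-split kr kr′
        ... | inj₁ kr | inj₂ kr′ = finish-r kr kr′
        ... | inj₂ kr | inj₁ kr′ = finish-r′ kr kr′
        ... | inj₂ kr | inj₂ kr′ = finish-none kr kr′

      lift : Solution S A N
      lift with bool (K b) | bool (K p) | bool (K q)
      ... | inj₁ kb | inj₁ kp | inj₁ kq = Both.both kb kp kq
      ... | inj₁ kb | inj₁ kp | inj₂ kq = finish-p kb kp kq
      ... | inj₁ kb | inj₂ kp | inj₁ kq = finish-q kb kp kq
      ... | inj₁ kb | inj₂ kp | inj₂ kq = finish-same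
        (λ { kx ky (inj₁ (_ , refl)) → true≢false ky kp ; kx ky (inj₂ (refl , _)) → true≢false kx kp })
        (λ { kx ky (inj₁ (_ , refl)) → true≢false ky kq ; kx ky (inj₂ (refl , _)) → true≢false kx kq })
      ... | inj₂ kb | _ | _ = finish-same
        (λ { kx ky (inj₁ (refl , _)) → true≢false kx kb ; kx ky (inj₂ (_ , refl)) → true≢false ky kb })
        (λ { kx ky (inj₁ (refl , _)) → true≢false kx kb ; kx ky (inj₂ (_ , refl)) → true≢false ky kb })

  contract : Solution S A N
  contract with solve (count-∖< {S = S} sa l) admissible₁
  ... | mkSolution K K⊆ fam out = Lift.lift K K⊆ fam out

-- Sequences over a finite set return to an earlier value

InjectiveBelow : ∀ {n} → (ℕ → Fin n) → ℕ → Set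
InjectiveBelow v k = ∀ {i j} → i < k → j < k → v i ≡ v j → i ≡ j

FirstReturn : ∀ {n} → (ℕ → Fin n) → Set
FirstReturn v = ∃ λ j → InjectiveBelow v j × ∃ λ i → (i < j) × (v i ≡ v j)

search-return : ∀ {n} (v : ℕ → Fin n) k → InjectiveBelow v k ⊎ FirstReturn v
search-return v zero = inj₁ λ ()
search-return v (suc k) with search-return v k
... | inj₂ r = inj₂ r
... | inj₁ inj with any? {n = k} (λ i → v (toℕ i) ≟ v k)
...   | yes (i , e) = inj₂ (k , inj , toℕ i , toℕ<n i , e)
...   | no ne = inj₁ inj′
  where
  new : ∀ {i} → i < k → v i ≡ v k → ⊥
  new l e = ne (fromℕ< l , trans (cong v (toℕ-fromℕ< l)) e)
  inj′ : InjectiveBelow v (suc k)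
  inj′ (s≤s i≤k) (s≤s j≤k) e with m≤n⇒m<n∨m≡n i≤k | m≤n⇒m<n∨m≡n j≤k
  ... | inj₁ i<k  | inj₁ j<k  = inj i<k j<k e
  ... | inj₁ i<k  | inj₂ refl = ⊥-elim (new i<k e)
  ... | inj₂ refl | inj₁ j<k  = ⊥-elim (new j<k (≡-sym e))
  ... | inj₂ refl | inj₂ refl = refl

first-return : ∀ {n} (v : ℕ → Fin n) → FirstReturn v
first-return {n} v with search-return v (suc n)
... | inj₂ r = r
... | inj₁ inj with pigeonhole (n<1+n n) (λ (i : Fin (suc n)) → v (toℕ i))
...   | i , j , i<j , e = ⊥-elim (<-irrefl (inj (toℕ<n i) (toℕ<n j) e) i<j)

-- Wheels all of whose rim vertices have degree three

-- By `link` the graph induced on `M` is 2-regular, so a walk from `w₀` that never turns back closes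
-- up to an induced cycle, all of whose vertices see `c`. Leaving `M` open lets the same argument
-- serve a component `K₄` and the neighbours of degree three of a larger hub.
module Wheel {n m} {S : VSet n} {A N s t} (solve : Solver n m) (l : count S < suc m)
  (ad : Admissible S A N s t) (all≥3 : ∀ {u} → S ∋ u → 3 ≤ deg S A u)
  {c : Fin n} (sc : S ∋ c) (M : Fin n → Set) (M⊆S : ∀ {w} → M w → S ∋ w) (M⊆N : ∀ {w} → M w → N ∋ w)
  (M≢c : ∀ {w} → M w → w ≢ c)
  (link : ∀ {w} → M w → ∃ λ u → ∃ λ u′ → M u × M u′ × Three (nb S A w) c u u′)
  {w₀ : Fin n} (mw₀ : M w₀) where

  open Admissible ad
  private
    el : ∀ {u x} → nb S A u ∋ x → (S ∋ x) × (A u x ≡ true)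
    el {u} {x} = nb-elim {S = S} {A} {u} {x}

    -- The state of the walk is an edge because the next vertex depends also on the one it came
    -- from.
    record Edge : Set where
      constructor mkEdge
      field
        u w : Fin n
        mu  : M u
        mw  : M w
        wu  : A w u ≡ true

    next : (e : Edge) → ∃ λ x → M x × Three (nb S A (Edge.w e)) c (Edge.u e) x
    next (mkEdge u w mu mw wu) with link mw
    ... | x , y , mx , my , t with Three.all t (∧-intro (M⊆S mu) wu)
    ...   | inj₁ h = ⊥-elim (M≢c mu h)
    ...   | inj₂ (inj₁ refl) = y , my , t
    ...   | inj₂ (inj₂ refl) = x , mx ,
      mkThree (Three.in₁ t) (Three.in₃ t) (Three.in₂ t) (Three.a≢c t) (Three.a≢b t) (Three.b≢c t ∘ ≡-sym)
        λ h → flip (Three.all t h)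
      where
      flip : ∀ {X Y Z : Set} → X ⊎ Y ⊎ Z → X ⊎ Z ⊎ Y
      flip (inj₁ a) = inj₁ a
      flip (inj₂ (inj₁ a)) = inj₂ (inj₂ a)
      flip (inj₂ (inj₂ a)) = inj₂ (inj₁ a)

    advance : Edge → Edge
    advance e = mkEdge (Edge.w e) (proj₁ (next e)) (Edge.mw e) (proj₁ (proj₂ (next e)))
      (trans (symA _ _) (proj₂ (el (Three.in₃ (proj₂ (proj₂ (next e)))))))

    edge : ℕ → Edge
    edge zero with link mw₀
    ... | u , _ , mu , _ , t = mkEdge w₀ u mw₀ mu (trans (symA _ _) (proj₂ (el (Three.in₂ t))))
    edge (suc k) = advance (edge k)

    v : ℕ → Fin n
    v k = Edge.u (edge k)

    M-v : ∀ k → M (v k)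
    M-v k = Edge.mu (edge k)

    around : ∀ k → Three (nb S A (v (suc k))) c (v k) (v (suc (suc k)))
    around k = proj₂ (proj₂ (next (edge k)))

    adj-v : ∀ k → A (v k) (v (suc k)) ≡ true
    adj-v k = trans (symA _ _) (proj₂ (el (Three.in₂ (around k))))

    step≢ : ∀ k → v k ≢ v (suc k)
    step≢ k e = true≢false (subst (λ x → A (v k) x ≡ true) (≡-sym e) (adj-v k)) (irrA (v k))

    skip≢ : ∀ k → v k ≢ v (suc (suc k))
    skip≢ k = Three.b≢c (around k)

    neighbour : ∀ {k x} → S ∋ x → A (v (suc k)) x ≡ true → x ≢ c → (x ≡ v k) ⊎ (x ≡ v (suc (suc k)))
    neighbour {k} sx e xc with Three.all (around k) (∧-intro sx e)
    ... | inj₁ h = ⊥-elim (xc h)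
    ... | inj₂ h = h

    -- Suppose the first repetition is a return to `v (suc i)`. The vertex before the return is then
    -- one of its two cycle neighbours, `v i` or `v (suc (suc i))`. This forces an earlier
    -- repetition or equal values one or two steps apart, all of which are excluded.
    returns-to-start : ∀ {i j} → InjectiveBelow v j → i < j → v i ≡ v j → v 0 ≡ v j
    returns-to-start {zero} inj i<j e = e
    returns-to-start {suc i} {suc j} inj (s≤s i<j) e
      with neighbour {i} (M⊆S (M-v j)) (subst (λ x → A x (v j) ≡ true) (≡-sym e) (trans (symA _ _) (adj-v j))) (M≢c (M-v j))
    ... | inj₁ h = ⊥-elim (<-irrefl (≡-sym (inj (n<1+n j) (<-trans i<j (n<1+n j)) h)) i<j)
    ... | inj₂ h with m≤n⇒m<n∨m≡n i<j
    ...   | inj₂ refl = ⊥-elim (step≢ (suc i) e)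
    ...   | inj₁ i+1<j with inj (n<1+n j) (s≤s i+1<j) h
    ...     | refl = ⊥-elim (skip≢ (suc i) e)

    ℓ : ℕ
    ℓ = proj₁ (first-return v)

    distinct : InjectiveBelow v ℓ
    distinct = proj₁ (proj₂ (first-return v))

    closed : v 0 ≡ v ℓ
    closed with first-return v
    ... | j , inj , i , i<j , e = returns-to-start inj i<j e

    positive : ∃ λ i → i < ℓ
    positive = let (_ , _ , i , i<j , _) = first-return v in i , i<j

    at-least-three : ∀ k → v 0 ≡ v k → (∃ λ i → i < k) → 3 ≤ k
    at-least-three zero                e (_ , ())
    at-least-three (suc zero)          e _ = ⊥-elim (step≢ 0 e)
    at-least-three (suc (suc zero))    e _ = ⊥-elim (skip≢ 0 e)
    at-least-three (suc (suc (suc k))) e _ = s≤s (s≤s (s≤s z≤n))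

    3≤ℓ : 3 ≤ ℓ
    3≤ℓ = at-least-three ℓ closed positive

    0<ℓ : 0 < ℓ
    0<ℓ = ≤-trans (s≤s z≤n) 3≤ℓ

    rim⇒adj : ∀ {i j} → RimNext ℓ i j → A (v i) (v j) ≡ true
    rim⇒adj {i} (inj₁ refl) = adj-v i
    rim⇒adj {i} (inj₂ (e , refl)) =
      subst (λ x → A (v i) x ≡ true) (trans (cong v e) (≡-sym closed)) (adj-v i)

    adj⇒rim-suc : ∀ {i j} → i < ℓ → suc j < ℓ → A (v (suc j)) (v i) ≡ true →
      RimNext ℓ i (suc j) ⊎ RimNext ℓ (suc j) i
    adj⇒rim-suc {i} {j} i<ℓ j<ℓ e with neighbour {j} (M⊆S (M-v i)) e (M≢c (M-v i))
    ... | inj₁ h = inj₁ (inj₁ (cong suc (distinct i<ℓ (<-trans (n<1+n j) j<ℓ) h)))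
    ... | inj₂ h with m≤n⇒m<n∨m≡n j<ℓ
    ...   | inj₁ j+2<ℓ = inj₂ (inj₁ (≡-sym (distinct i<ℓ j+2<ℓ h)))
    ...   | inj₂ e′ = inj₂ (inj₂ (e′ , distinct i<ℓ 0<ℓ (trans h (trans (cong v e′) (≡-sym closed)))))

    adj⇒rim : ∀ i j → i < ℓ → j < ℓ → A (v i) (v j) ≡ true → RimNext ℓ i j ⊎ RimNext ℓ j i
    adj⇒rim zero    zero    _   _   e = ⊥-elim (true≢false e (irrA (v 0)))
    adj⇒rim i       (suc j) i<ℓ j<ℓ e = adj⇒rim-suc i<ℓ j<ℓ (trans (symA _ _) e)
    adj⇒rim (suc i) zero    i<ℓ j<ℓ e = ⊎-swap (adj⇒rim-suc j<ℓ i<ℓ e)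

    rim : VSet n
    rim x = ⌊ any? {n = ℓ} (λ i → v (toℕ i) ≟ x) ⌋

    rim-out : ∀ {x} → rim ∋ x → ∃ λ i → (i < ℓ) × (v i ≡ x)
    rim-out {x} h with any? {n = ℓ} (λ i → v (toℕ i) ≟ x)
    rim-out {x} h  | yes (i , e) = toℕ i , toℕ<n i , e
    rim-out {x} () | no _

    rim-in : ∀ {i} → i < ℓ → rim ∋ v i
    rim-in {i} i<ℓ with any? {n = ℓ} (λ j → v (toℕ j) ≟ v i)
    ... | yes _ = refl
    ... | no ne = ⊥-elim (ne (fromℕ< i<ℓ , cong v (toℕ-fromℕ< i<ℓ)))

    rim-in′ : ∀ {k} → k ≤ ℓ → rim ∋ v k
    rim-in′ k≤ℓ with m≤n⇒m<n∨m≡n k≤ℓ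
    ... | inj₁ k<ℓ = rim-in k<ℓ
    ... | inj₂ refl = subst (rim ∋_) closed (rim-in 0<ℓ)

    rim⊆M : ∀ {x} → rim ∋ x → M x
    rim⊆M h with rim-out h
    ... | i , _ , refl = M-v i

    -- `neighbour` describes only vertices of positive index, so the surroundings of `v 0` are read
    -- off at the return index. The walk does not turn back there: `v 1` differs from the vertex
    -- before the return, since the cycle has at least three vertices.
    after-ℓ : ∀ {k} → 3 ≤ k → InjectiveBelow v k → v 0 ≡ v k → v 1 ≡ v (suc k)
    after-ℓ {suc k} (s≤s (s≤s 1≤k)) inj e
      with neighbour {k} (M⊆S (M-v 1)) (subst (λ x → A x (v 1) ≡ true) e (adj-v 0)) (M≢c (M-v 1))
    ... | inj₂ h = h
    ... | inj₁ h with inj (s≤s (s≤s z≤n)) (n<1+n k) h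
    ...   | refl with 1≤k
    ...     | ()

    rim-closed : ∀ {x y} → rim ∋ x → S ∋ y → A x y ≡ true → (y ≡ c) ⊎ (rim ∋ y)
    rim-closed {x} {y} rx sy e with y ≟ c
    ... | yes h = inj₁ h
    ... | no yc with rim-out rx
    ...   | suc i , i<ℓ , refl with neighbour {i} sy e yc
    ...     | inj₁ refl = inj₂ (rim-in (<-trans (n<1+n i) i<ℓ))
    ...     | inj₂ refl = inj₂ (rim-in′ i<ℓ)
    rim-closed {x} {y} rx sy e | no yc | zero , _ , refl =
      go (neighbour′ ℓ 3≤ℓ closed)
      where
      neighbour′ : ∀ k → 3 ≤ k → v 0 ≡ v k → ∃ λ k′ → (suc k′ ≡ k) × ((y ≡ v k′) ⊎ (y ≡ v (suc k)))
      neighbour′ (suc k) _ e₀ = k , refl , neighbour {k} sy (subst (λ z → A z y ≡ true) e₀ e) yc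
      go : (∃ λ k′ → (suc k′ ≡ ℓ) × ((y ≡ v k′) ⊎ (y ≡ v (suc ℓ)))) → (y ≡ c) ⊎ (rim ∋ y)
      go (k′ , e₁ , inj₁ refl) = inj₂ (rim-in (≤-reflexive e₁))
      go (_ , _ , inj₂ h) = inj₂ (subst (rim ∋_)
        (≡-sym (trans h (≡-sym (after-ℓ 3≤ℓ distinct closed)))) (rim-in (≤-trans (s≤s (s≤s z≤n)) 3≤ℓ)))

    hub-adj : ∀ {x} → M x → A c x ≡ true
    hub-adj {x} mx with link mx
    ... | _ , _ , _ , _ , t = trans (symA c x) (proj₂ (el (Three.in₁ t)))

    spokes : Fin (suc ℓ) → Fin n
    spokes zero    = c
    spokes (suc i) = v (toℕ i)

    whole : (∀ {u} → S ∋ u → (u ≡ c) ⊎ (rim ∋ u)) → Solution S A N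
    whole all = mkSolution S id
      (mkFam (inj₁ (ℓ , 3≤ℓ , base)) spokes spokes-inj cover inS ind)
      (λ su nu → ⊥-elim (true≢false su nu))
      where
      spokes-inj : Injective _≡_ _≡_ spokes
      spokes-inj {zero}  {zero}  e = refl
      spokes-inj {zero}  {suc j} e = ⊥-elim (M≢c (M-v (toℕ j)) (≡-sym e))
      spokes-inj {suc i} {zero}  e = ⊥-elim (M≢c (M-v (toℕ i)) e)
      spokes-inj {suc i} {suc j} e = cong suc (toℕ-injective (distinct (toℕ<n i) (toℕ<n j) e))
      cover : ∀ {x} → S ∋ x → ∃ λ i → spokes i ≡ x
      cover sx with all sx
      ... | inj₁ refl = zero , refl
      ... | inj₂ rx with rim-out rx
      ...   | i , i<ℓ , refl = suc (fromℕ< i<ℓ) , cong v (toℕ-fromℕ< i<ℓ)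
      inS : ∀ i → S ∋ spokes i
      inS zero    = sc
      inS (suc i) = M⊆S (M-v (toℕ i))
      ind : ∀ i j → A (spokes i) (spokes j) ≡ wheel ℓ i j
      ind zero    zero    = irrA c
      ind zero    (suc j) = hub-adj (M-v (toℕ j))
      ind (suc i) zero    = trans (symA _ _) (hub-adj (M-v (toℕ i)))
      ind (suc i) (suc j) = bool-ext
        (λ e → rim-intro ℓ i j (adj⇒rim (toℕ i) (toℕ j) (toℕ<n i) (toℕ<n j) e))
        (λ e → back (rim-elim ℓ i j e))
        where
        back : RimNext ℓ (toℕ i) (toℕ j) ⊎ RimNext ℓ (toℕ j) (toℕ i) → A (v (toℕ i)) (v (toℕ j)) ≡ true
        back (inj₁ r) = rim⇒adj r
        back (inj₂ r) = trans (symA _ _) (rim⇒adj r)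

    -- The wheel itself may fail here, since its hub can separate other vertices from `N`. Removing
    -- the rim alone is harmless: it lies in `N`, its only outside neighbour is `c`, so only `c`
    -- loses degree, and `c` can leave through the rim.
    part : ∀ {o} → S ∋ o → o ≢ c → rim ∌ o → Solution S A N
    part {o} so oc ro = solution-extend {S₁ = S₁} {N₁ = N₁} (λ h → proj₁ (S₁-elim h)) dead new
      (solve smaller ad₁)
      where
      S₁ N₁ : VSet n
      S₁ x = S x ∧ not (rim x)
      N₁ = N ⊕ c
      S₁-elim : ∀ {x} → S₁ ∋ x → (S ∋ x) × (rim ∌ x)
      S₁-elim {x} h = let (i , j) = ∧-elim {S x} h in i , not-true j
      S₁-intro : ∀ {x} → S ∋ x → rim ∌ x → S₁ ∋ x
      S₁-intro sx rx = ∧-intro sx (cong not rx)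
      in-rim : ∀ {x} → S ∋ x → S₁ ∌ x → rim ∋ x
      in-rim {x} sx h with bool (rim x)
      ... | inj₁ r = r
      ... | inj₂ r = ⊥-elim (true≢false (S₁-intro sx r) h)
      r₀ : rim ∋ v 0
      r₀ = rim-in 0<ℓ
      v₀∉ : S₁ ∋ v 0 → ⊥
      v₀∉ h = true≢false r₀ (proj₂ (S₁-elim h))
      smaller : count S₁ < m
      smaller = ≤-trans (s≤s (count-mono {p = S₁} {S ∖ v 0} λ x h →
          ∖-intro {p = S} (proj₁ (S₁-elim h)) λ { refl → v₀∉ h }))
        (count-∖< {S = S} (M⊆S (M-v 0)) l)
      dead : ∀ {u} → S ∋ u → S₁ ∌ u → N ∋ u
      dead su h = M⊆N (rim⊆M (in-rim su h))
      new : ∀ {u} → S₁ ∋ u → N₁ ∋ u → (N ∋ u) ⊎ (∃ λ w → (S ∋ w) × (S₁ ∌ w) × (A u w ≡ true))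
      new _ h with ⊕-elim {p = N} h
      ... | inj₁ e = inj₁ e
      ... | inj₂ refl = inj₂ (v 0 , M⊆S (M-v 0) , ¬true⇒false v₀∉ , hub-adj (M-v 0))
      far : ∀ {u x} → S₁ ∋ u → u ≢ c → rim ∋ x → A u x ≡ true → ⊥
      far {u} {x} su uc rx e with rim-closed rx (proj₁ (S₁-elim su)) (trans (symA x u) e)
      ... | inj₁ h = uc h
      ... | inj₂ h = true≢false h (proj₂ (S₁-elim su))
      kept : ∀ {u} → S₁ ∋ u → u ≢ c → deg S A u ≤ deg S₁ A u
      kept {u} su uc = count-mono {p = nb S A u} λ x h → let (i , j) = el {u} {x} h in
        ∧-intro (S₁-intro i (¬true⇒false λ r → far su uc r j)) j
      cut : ∀ {u w} → S₁ ∋ u → S ∋ w → S₁ ∌ w → A u w ≡ true → N₁ ∋ u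
      cut {u} su sw nw e with u ≟ c
      ... | yes refl = ⊕-new N c
      ... | no uc = ⊥-elim (far su uc (in-rim sw nw) e)
      -- `v 0` is on the removed rim, so `c` is the only exempt vertex.
      ad₁ : Admissible S₁ A N₁ (v 0) c
      ad₁ = record
        { symA = symA ; irrA = irrA ; paired = λ h → ⊥-elim (v₀∉ h) ; s∈N = λ h → ⊥-elim (v₀∉ h)
        ; t∈N = λ _ → ⊕-new N c
        ; deg≥3 = λ su _ uc → ≤-trans (all≥3 (proj₁ (S₁-elim su))) (kept su uc)
        ; deg≥4 = λ su nu → ≤-trans (deg≥4 (proj₁ (S₁-elim su)) (proj₁ (⊕-out {p = N} nu)))
            (kept su (proj₂ (⊕-out {p = N} nu)))
        ; reach = λ su → restrict-reach (λ _ → ⊕-old {p = N}) cut (proj₁ (S₁-elim su)) (reach (proj₁ (S₁-elim su))) su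
        ; other = o , S₁-intro so ro , (λ { refl → true≢false r₀ ro }) , oc }

  wheel-solution : Solution S A N
  wheel-solution with any? (λ o → (S o ≟ᵇ true) ×-dec (¬? (o ≟ c) ×-dec (rim o ≟ᵇ false)))
  ... | yes (o , so , oc , ro) = part so oc ro
  ... | no none = whole all
    where
    all : ∀ {u} → S ∋ u → (u ≡ c) ⊎ (rim ∋ u)
    all {u} su with u ≟ c | bool (rim u)
    ... | yes e | _ = inj₁ e
    ... | no _ | inj₁ r = inj₂ r
    ... | no uc | inj₂ r = ⊥-elim (none (u , su , uc , r))

-- Minimum degree three

module Core {n m} {S : VSet n} {A N s t} (solve : Solver n m) (l : count S < suc m)
  (ad : Admissible S A N s t) (all≥3 : ∀ {u} → S ∋ u → 3 ≤ deg S A u) where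

  open Admissible ad
  private
    el : ∀ {u x} → nb S A u ∋ x → (S ∋ x) × (A u x ≡ true)
    el {u} {x} = nb-elim {S = S} {A} {u} {x}

    cubic∈N : ∀ {v} → S ∋ v → deg S A v ≡ 3 → N ∋ v
    cubic∈N {v} sv d with bool (N v)
    ... | inj₁ e = e
    ... | inj₂ e = ⊥-elim (4≰3 (subst (4 ≤_) d (deg≥4 sv e)))
      where
      4≰3 : 4 ≤ 3 → ⊥
      4≰3 (s≤s (s≤s (s≤s ())))

    not-cubic : ∀ {v} → S ∋ v → deg S A v ≢ 3 → 4 ≤ deg S A v
    not-cubic sv d = ≤∧≢⇒< (all≥3 sv) (d ∘ ≡-sym)

    adj≢ : ∀ {x y} → A x y ≡ true → x ≢ y
    adj≢ {x} e refl = true≢false e (irrA x)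

  CubicPair : Fin n → Fin n → Fin n → Set
  CubicPair v a b = nb S A v ∋ a × nb S A v ∋ b × a ≢ b × A a b ≡ false × deg S A a ≡ 3 × deg S A b ≡ 3

  HasPair : Fin n → Set
  HasPair v = ∃ λ a → ∃ λ b → CubicPair v a b

  hasPair? : ∀ v → Dec (HasPair v)
  hasPair? v = any? λ a → any? λ b → (nb S A v a ≟ᵇ true) ×-dec ((nb S A v b ≟ᵇ true) ×-dec
    (¬? (a ≟ b) ×-dec ((A a b ≟ᵇ false) ×-dec
    ((deg S A a ≟ⁿ 3) ×-dec (deg S A b ≟ⁿ 3)))))

  Triangle : Fin n → Fin n → Set
  Triangle a b = ∃ λ y → nb S A a ∋ y × nb S A b ∋ y

  triangle? : ∀ a b → Dec (Triangle a b)
  triangle? a b = any? λ y → (nb S A a y ≟ᵇ true) ×-dec (nb S A b y ≟ᵇ true)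

  module NoPair {v} (sv : S ∋ v) (dv : deg S A v ≡ 3) (none : ¬ HasPair v) where

    joined : ∀ {a b} → nb S A v ∋ a → nb S A v ∋ b → a ≢ b → deg S A a ≡ 3 → deg S A b ≡ 3 → A a b ≡ true
    joined {a} {b} ha hb ab da db with bool (A a b)
    ... | inj₁ e = e
    ... | inj₂ e = ⊥-elim (none (a , b , ha , hb , ab , e , da , db))

    v-dead : ∀ {X : Set} → S ∖ v ∋ v → X
    v-dead h = ⊥-elim (proj₂ (∖-elim {p = S} h) refl)

    -- `c` has degree at least four and can afford the loss. The neighbours of degree three are then
    -- at most two, and if there are two they are adjacent by `joined`, so they qualify for
    -- exemption. `c` also witnesses `other`.
    remove : ∀ {a b c} → Three (nb S A v) a b c → deg S A c ≢ 3 → Solution S A N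
    remove {a} {b} {c} t dc with deg S A a ≟ⁿ 3 | deg S A b ≟ⁿ 3
    ... | yes da | yes db = delete solve l ad sv (cubic∈N sv dv) a b
        (λ _ _ → joined in₁ in₂ a≢b da db) (λ _ → inj₁ (proj₂ (el in₁))) (λ _ → inj₁ (proj₂ (el in₂)))
        d3 (c , proj₁ (el in₃) , (adj≢ (proj₂ (el in₃)) ∘ ≡-sym) , (a≢c ∘ ≡-sym) , (b≢c ∘ ≡-sym))
      where
      open Three t
      d3 : ∀ {u} → S ∋ u → u ≢ v → u ≢ a → u ≢ b → 3 ≤ deg (S ∖ v) A u
      d3 {u} su uv ua ub with bool (A u v)
      ... | inj₂ e = deg-∖-nonadj {S = S} {A} e (all≥3 su)
      ... | inj₁ e with all (∧-intro su (trans (symA v u) e))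
      ...   | inj₁ h = ⊥-elim (ua h)
      ...   | inj₂ (inj₁ h) = ⊥-elim (ub h)
      ...   | inj₂ (inj₂ refl) = deg-∖-adj {S = S} {A} (not-cubic su dc)
    ... | no da | _ = delete solve l ad sv (cubic∈N sv dv) v b v-dead v-dead (λ _ → inj₁ (proj₂ (el in₂)))
        d3 (c , proj₁ (el in₃) , (adj≢ (proj₂ (el in₃)) ∘ ≡-sym) , (adj≢ (proj₂ (el in₃)) ∘ ≡-sym) , (b≢c ∘ ≡-sym))
      where
      open Three t
      d3 : ∀ {u} → S ∋ u → u ≢ v → u ≢ v → u ≢ b → 3 ≤ deg (S ∖ v) A u
      d3 {u} su uv _ ub with bool (A u v)
      ... | inj₂ e = deg-∖-nonadj {S = S} {A} e (all≥3 su)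
      ... | inj₁ e with all (∧-intro su (trans (symA v u) e))
      ...   | inj₁ refl = deg-∖-adj {S = S} {A} (not-cubic su da)
      ...   | inj₂ (inj₁ h) = ⊥-elim (ub h)
      ...   | inj₂ (inj₂ refl) = deg-∖-adj {S = S} {A} (not-cubic su dc)
    ... | yes _ | no db = delete solve l ad sv (cubic∈N sv dv) v a v-dead v-dead (λ _ → inj₁ (proj₂ (el in₁)))
        d3 (c , proj₁ (el in₃) , (adj≢ (proj₂ (el in₃)) ∘ ≡-sym) , (adj≢ (proj₂ (el in₃)) ∘ ≡-sym) , (a≢c ∘ ≡-sym))
      where
      open Three t
      d3 : ∀ {u} → S ∋ u → u ≢ v → u ≢ v → u ≢ a → 3 ≤ deg (S ∖ v) A u
      d3 {u} su uv _ ua with bool (A u v)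
      ... | inj₂ e = deg-∖-nonadj {S = S} {A} e (all≥3 su)
      ... | inj₁ e with all (∧-intro su (trans (symA v u) e))
      ...   | inj₁ h = ⊥-elim (ua h)
      ...   | inj₂ (inj₁ refl) = deg-∖-adj {S = S} {A} (not-cubic su db)
      ...   | inj₂ (inj₂ refl) = deg-∖-adj {S = S} {A} (not-cubic su dc)

    -- The four vertices are pairwise adjacent, so any of them can be the hub. If `S` has further
    -- vertices, `Wheel` removes the other three and leaves `c` as an exempt isolated vertex.
    K₄-component : ∀ {a b c} → Three (nb S A v) a b c → deg S A a ≡ 3 → deg S A b ≡ 3 → deg S A c ≡ 3 →
      Solution S A N
    K₄-component {a} {b} {c} t da db dc = Wheel.wheel-solution solve l ad all≥3 (proj₁ (el in₃))
      M M⊆S M⊆N M≢c link (inj₁ refl)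
      where
      open Three t
      ab : A a b ≡ true
      ab = joined in₁ in₂ a≢b da db
      ac : A a c ≡ true
      ac = joined in₁ in₃ a≢c da dc
      bc : A b c ≡ true
      bc = joined in₂ in₃ b≢c db dc
      flip : ∀ {x y} → A x y ≡ true → A y x ≡ true
      flip {x} {y} e = trans (symA y x) e
      sa : S ∋ a
      sa = proj₁ (el in₁)
      sb : S ∋ b
      sb = proj₁ (el in₂)
      sc : S ∋ c
      sc = proj₁ (el in₃)
      va : A v a ≡ true
      va = proj₂ (el in₁)
      vb : A v b ≡ true
      vb = proj₂ (el in₂)
      M : Fin n → Set
      M x = (x ≡ v) ⊎ (x ≡ a) ⊎ (x ≡ b)
      M⊆S : ∀ {w} → M w → S ∋ w
      M⊆S (inj₁ refl) = sv
      M⊆S (inj₂ (inj₁ refl)) = sa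
      M⊆S (inj₂ (inj₂ refl)) = sb
      M⊆N : ∀ {w} → M w → N ∋ w
      M⊆N (inj₁ refl) = cubic∈N sv dv
      M⊆N (inj₂ (inj₁ refl)) = cubic∈N sa da
      M⊆N (inj₂ (inj₂ refl)) = cubic∈N sb db
      M≢c : ∀ {w} → M w → w ≢ c
      M≢c (inj₁ refl) = adj≢ (proj₂ (el in₃))
      M≢c (inj₂ (inj₁ refl)) = a≢c
      M≢c (inj₂ (inj₂ refl)) = b≢c
      link : ∀ {w} → M w → ∃ λ u → ∃ λ u′ → M u × M u′ × Three (nb S A w) c u u′
      link (inj₁ refl) = a , b , inj₂ (inj₁ refl) , inj₂ (inj₂ refl) ,
        three-rotate (three-rotate t)
      link (inj₂ (inj₁ refl)) = v , b , inj₁ refl , inj₂ (inj₂ refl) ,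
        three-intro {p = nb S A a} da (∧-intro sc ac) (∧-intro sv (flip va)) (∧-intro sb ab)
          (adj≢ (proj₂ (el in₃)) ∘ ≡-sym) (b≢c ∘ ≡-sym) (adj≢ vb)
      link (inj₂ (inj₂ refl)) = v , a , inj₁ refl , inj₂ (inj₁ refl) ,
        three-intro {p = nb S A b} db (∧-intro sc bc) (∧-intro sv (flip vb)) (∧-intro sa (flip ab))
          (adj≢ (proj₂ (el in₃)) ∘ ≡-sym) (a≢c ∘ ≡-sym) (adj≢ va)

    no-pair : Solution S A N
    no-pair with three-elements {p = nb S A v} dv
    ... | a , b , c , t with deg S A a ≟ⁿ 3 | deg S A b ≟ⁿ 3 | deg S A c ≟ⁿ 3
    ...   | yes da | yes db | yes dc = K₄-component t da db dc
    ...   | _ | _ | no dc = remove t dc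
    ...   | _ | no db | yes _ = remove (three-rotate (three-rotate t)) db
    ...   | no da | yes _ | yes _ = remove (three-rotate t) da

  -- All degrees are at least four, so any vertex may be deleted without creating exemptions. It
  -- only has to lie in `N`, and the end of a path given by `reach` does.
  no-cubic : (∀ {v} → S ∋ v → deg S A v ≢ 3) → Solution S A N
  no-cubic none = go
    where
    exit : ∃ λ v → (S ∋ v) × (N ∋ v)
    exit = let (o , so , _) = other in
      reach-fold (λ _ → ∃ λ v → (S ∋ v) × (N ∋ v)) (λ {u} su nu → u , su , nu) (λ _ _ _ x → x) so (reach so)
    go : Solution S A N
    go with exit
    ... | v , sv , nv with another-neighbour {S = S} {A} {v} {v} {v} irrA (all≥3 sv)
    ...   | u , su , uv , _ = delete solve l ad sv nv v v dead dead dead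
              (λ su′ _ _ _ → deg-∖-adj {S = S} {A} (not-cubic su′ (none su′))) (u , su , uv , uv , uv)
      where
      dead : ∀ {X : Set} → S ∖ v ∋ v → X
      dead h = ⊥-elim (proj₂ (∖-elim {p = S} h) refl)

  no-triangle : ∀ {a b} → S ∋ a → S ∋ b → deg S A a ≡ 3 → deg S A b ≡ 3 → A a b ≡ true →
    ¬ Triangle a b → Solution S A N
  no-triangle {a} {b} sa sb da db ab nt
    with count-pick {p = nb S A a ∖ b} (suc-injective (trans (≡-sym (count-remove {p = nb S A a} (∧-intro sb ab))) da))
       | count-pick {p = nb S A b ∖ a} (suc-injective (trans (≡-sym (count-remove {p = nb S A b} (∧-intro sa (trans (symA b a) ab)))) db))
  ... | p , hp , _ | r , hr , _ with ∖-elim {p = nb S A a} {b} {p} hp | ∖-elim {p = nb S A b} {a} {r} hr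
  ...   | ap , pb | br , ra
    with three-third {p = nb S A a} da (∧-intro sb ab) ap (pb ∘ ≡-sym)
       | three-third {p = nb S A b} db (∧-intro sa (trans (symA b a) ab)) br (ra ∘ ≡-sym)
  ...     | q , ta | r′ , tb = Contraction.contract solve l ad all≥3 sa sb
    (cubic∈N sa da) (cubic∈N sb db) ta tb (apart (Three.in₂ ta)) (apart (Three.in₃ ta))
    where
    apart : ∀ {y} → nb S A a ∋ y → A b y ≡ false
    apart {y} h = ¬true⇒false λ e → nt (y , h , ∧-intro (proj₁ (el h)) e)

  module Triangulated
    (pairs : ∀ {v} → S ∋ v → deg S A v ≡ 3 → HasPair v)
    (triangles : ∀ {a b} → S ∋ a → S ∋ b → deg S A a ≡ 3 → deg S A b ≡ 3 → A a b ≡ true → Triangle a b) where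

    -- A common neighbour of v and a is neither a nor the nonneighbour b of a.
    toward-hub : ∀ {v a b c} → S ∋ v → deg S A v ≡ 3 → Three (nb S A v) a b c → A a b ≡ false →
      deg S A a ≡ 3 → A a c ≡ true
    toward-hub sv dv t ab da with triangles sv (proj₁ (el (Three.in₁ t))) dv da (proj₂ (el (Three.in₁ t)))
    ... | y , vy , ay with Three.all t vy
    ...   | inj₁ refl = ⊥-elim (true≢false (proj₂ (el ay)) (irrA _))
    ...   | inj₂ (inj₁ refl) = ⊥-elim (true≢false (proj₂ (el ay)) ab)
    ...   | inj₂ (inj₂ refl) = proj₂ (el ay)

    three-swap : ∀ {p : VSet n} {a b c} → Three p a b c → Three p b a c
    three-swap (mkThree i j k ab ac bc all) = mkThree j i k (ab ∘ ≡-sym) bc ac λ h → flip (all h)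
      where
      flip : ∀ {X Y Z : Set} → X ⊎ Y ⊎ Z → Y ⊎ X ⊎ Z
      flip (inj₁ x) = inj₂ (inj₁ x)
      flip (inj₂ (inj₁ y)) = inj₁ y
      flip (inj₂ (inj₂ z)) = inj₂ (inj₂ z)

    -- Otherwise the neighbours of `c` are exactly `v`, `a`, `b`. The pair at `a` is not `v`, `c`,
    -- which are adjacent, so the third neighbour `x` of `a` has degree three and the edge `ax` lies
    -- in a triangle. Its third corner is `v` or `c`, and the neighbours of these leave only `b` for
    -- `x`, although `a` and `b` are not adjacent.
    hub-not-cubic : ∀ {v a b c} → S ∋ v → deg S A v ≡ 3 → Three (nb S A v) a b c → A a b ≡ false →
      deg S A a ≡ 3 → deg S A b ≡ 3 → deg S A c ≢ 3
    hub-not-cubic {v} {a} {b} {c} sv dv t ab da db dc = third-neighbour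
      (three-third {p = nb S A a} da (∧-intro sv (flip va)) (∧-intro sc ac) (adj≢ vc))
      where
      flip : ∀ {x y} → A x y ≡ true → A y x ≡ true
      flip {x} {y} e = trans (symA y x) e
      va : A v a ≡ true
      va = proj₂ (el (Three.in₁ t))
      vb : A v b ≡ true
      vb = proj₂ (el (Three.in₂ t))
      vc : A v c ≡ true
      vc = proj₂ (el (Three.in₃ t))
      sa : S ∋ a
      sa = proj₁ (el (Three.in₁ t))
      sb : S ∋ b
      sb = proj₁ (el (Three.in₂ t))
      sc : S ∋ c
      sc = proj₁ (el (Three.in₃ t))
      ac : A a c ≡ true
      ac = toward-hub sv dv t ab da
      bc : A b c ≡ true
      bc = toward-hub sv dv (three-swap t) (trans (symA b a) ab) db
      tc : Three (nb S A c) v a b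
      tc = three-intro {p = nb S A c} dc (∧-intro sv (flip vc)) (∧-intro sa (flip ac)) (∧-intro sb (flip bc))
        (adj≢ va) (adj≢ vb) (Three.a≢b t)
      third-neighbour : (∃ λ x → Three (nb S A a) v c x) → ⊥
      third-neighbour (x , ta) = no-common (triangles sa sx da (cubic-x (pairs sa da)) ax)
        where
        sx : S ∋ x
        sx = proj₁ (el (Three.in₃ ta))
        ax : A a x ≡ true
        ax = proj₂ (el (Three.in₃ ta))
        cubic-x : HasPair a → deg S A x ≡ 3
        cubic-x (y , z , hy , hz , yz , nyz , dy , dz) with Three.all ta hy | Three.all ta hz
        ... | inj₂ (inj₂ refl) | _ = dy
        ... | _ | inj₂ (inj₂ refl) = dz
        ... | inj₁ refl | inj₁ refl = ⊥-elim (yz refl)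
        ... | inj₁ refl | inj₂ (inj₁ refl) = ⊥-elim (true≢false vc nyz)
        ... | inj₂ (inj₁ refl) | inj₁ refl = ⊥-elim (true≢false (flip vc) nyz)
        ... | inj₂ (inj₁ refl) | inj₂ (inj₁ refl) = ⊥-elim (yz refl)
        x≢b : x ≢ b
        x≢b refl = true≢false ax ab
        no-common : Triangle a x → ⊥
        no-common (y , hy , xy) with Three.all ta hy
        ... | inj₂ (inj₂ refl) = true≢false (proj₂ (el xy)) (irrA x)
        ... | inj₁ refl with Three.all t (∧-intro sx (flip (proj₂ (el xy))))
        ...   | inj₁ h = adj≢ ax (≡-sym h)
        ...   | inj₂ (inj₁ h) = x≢b h
        ...   | inj₂ (inj₂ h) = Three.b≢c ta (≡-sym h)
        no-common (y , hy , xy) | inj₂ (inj₁ refl) with Three.all tc (∧-intro sx (flip (proj₂ (el xy))))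
        ...   | inj₁ h = Three.a≢c ta (≡-sym h)
        ...   | inj₂ (inj₁ h) = adj≢ ax (≡-sym h)
        ...   | inj₂ (inj₂ h) = x≢b h

    -- As `c` does not have degree three, the pair at a vertex of `M` consists of its two neighbours
    -- other than `c`. By `toward-hub` both of these see `c`, so they are in `M` again.
    around-hub : ∀ {w c} → S ∋ w → S ∋ c → deg S A w ≡ 3 → deg S A c ≢ 3 → A w c ≡ true → Solution S A N
    around-hub {w} {c} sw sc dw dc wc = Wheel.wheel-solution solve l ad all≥3 sc M proj₁
      (λ (sx , dx , _) → cubic∈N sx dx) (λ (_ , _ , xc) → adj≢ xc) link (sw , dw , wc)
      where
      M : Fin n → Set
      M x = (S ∋ x) × (deg S A x ≡ 3) × (A x c ≡ true)
      link : ∀ {x} → M x → ∃ λ u → ∃ λ u′ → M u × M u′ × Three (nb S A x) c u u′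
      link {x} (sx , dx , xc) with pairs sx dx
      ... | a , b , ha , hb , ab , nab , da , db = a , b ,
        (proj₁ (el ha) , da , toward-hub sx dx (three-rotate tx) nab da) ,
        (proj₁ (el hb) , db , toward-hub sx dx (three-swap (three-rotate tx)) (trans (symA b a) nab) db) , tx
        where
        tx : Three (nb S A x) c a b
        tx = three-intro {p = nb S A x} dx (∧-intro sc xc) ha hb (λ { refl → dc da }) (λ { refl → dc db }) ab

    triangulated : ∀ {v} → S ∋ v → deg S A v ≡ 3 → Solution S A N
    triangulated {v} sv dv with pairs sv dv
    ... | a , b , ha , hb , ab , nab , da , db with three-third {p = nb S A v} dv ha hb ab
    ...   | c , t = around-hub sv (proj₁ (el (Three.in₃ t))) dv (hub-not-cubic sv dv t nab da db) (proj₂ (el (Three.in₃ t)))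

  core : Solution S A N
  core with any? (λ v → (S v ≟ᵇ true) ×-dec ((deg S A v ≟ⁿ 3) ×-dec ¬? (hasPair? v)))
  ... | yes (v , sv , dv , np) = NoPair.no-pair sv dv np
  ... | no pairs with any? (λ a → any? λ b → (S a ≟ᵇ true) ×-dec ((S b ≟ᵇ true) ×-dec
      ((deg S A a ≟ⁿ 3) ×-dec ((deg S A b ≟ⁿ 3) ×-dec ((A a b ≟ᵇ true) ×-dec ¬? (triangle? a b))))))
  ...   | yes (a , b , sa , sb , da , db , ab , nt) = no-triangle sa sb da db ab nt
  ...   | no triangles with any? (λ v → (S v ≟ᵇ true) ×-dec (deg S A v ≟ⁿ 3))
  ...     | no none = no-cubic λ {v} sv dv → none (v , sv , dv)
  ...     | yes (v , sv , dv) = Triangulated.triangulated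
    (λ {x} sx dx → decidable-stable (hasPair? x) λ np → pairs (x , sx , dx , np))
    (λ {a} {b} sa sb da db ab → decidable-stable (triangle? a b) λ nt → triangles (a , b , sa , sb , da , db , ab , nt))
    sv dv

-- The induction on the number of vertices

solver : ∀ n m → Solver n m
solver n zero    ()
solver n (suc m) {S} {A} {N} {s} {t} l ad
  with (S s ≟ᵇ true) ×-dec (deg S A s ≤? 2) | (S t ≟ᵇ true) ×-dec (deg S A t ≤? 2)
... | yes (ss , d) | _            = low-degree (solver n m) l ad ss d
... | no _         | yes (st , d) = low-degree (solver n m) l (admissible-swap ad) st d
... | no ns        | no nt        = Core.core (solver n m) l ad all≥3
  where
  all≥3 : ∀ {u} → S ∋ u → 3 ≤ deg S A u
  all≥3 {u} su with u ≟ s | u ≟ t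
  ... | yes refl | _        = ≰⇒> λ d → ns (su , d)
  ... | no _     | yes refl = ≰⇒> λ d → nt (su , d)
  ... | no us    | no ut    = Admissible.deg≥3 ad su us ut

-- Translation to `Subset` and walks, and the theorem

member : ∀ {n} {K : VSet n} {x} → K ∋ x → x ∈ tabulateᵛ K
member {K = K} {x} h = lookup⇒[]= x _ (trans (lookup∘tabulate K x) h)

member⁻¹ : ∀ {n} {K : VSet n} {x} → x ∈ tabulateᵛ K → K ∋ x
member⁻¹ {K = K} {x} h = trans (≡-sym (lookup∘tabulate K x)) ([]=⇒lookup h)

module _ {G : SimpleGraph} {T : Subset (n G)} where

  walk-append : ∀ {u v w} → WalkIn G T u v → WalkIn G T v w → WalkIn G T u w
  walk-append here          q = q
  walk-append (step e t p) q = step e t (walk-append p q)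

  walk-reverse : ∀ {u v} → u ∈ T → WalkIn G T u v → WalkIn G T v u
  walk-reverse _ here         = here
  walk-reverse h (step {u} {w} e t p) =
    walk-append (walk-reverse t p) (step (trans (sym G w u) e) h here)

theorem6 : (G : SimpleGraph) → Connected G → MinDegreeAtLeast 4 G → (x : Fin (n G)) →
    Σ (Subset (n G)) λ S →
    ((Σ ℕ λ ℓ → (3 ≤ ℓ) × IsoToSubdivisionOf G S _ (wheel ℓ))
    ⊎ IsoToSubdivisionOf G S 6 prism
    ⊎ IsoToSubdivisionOf G S 6 K33)
    × ConnectedOn G (∁ S)
    × x ∉ S
theorem6 G conn deg≥4 x = answer (solver (n G) _ (n<1+n _) start)
  where
  V N : VSet (n G)
  V = full ∖ x
  N = adj G x
  ≢x : ∀ {u} → V ∋ u → u ≢ x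
  ≢x h = proj₂ (∖-elim {p = full} h)
  V-intro : ∀ {u} → u ≢ x → V ∋ u
  V-intro = ∖-intro {p = full} refl
  degree≥4 : ∀ u → 4 ≤ deg full (adj G) u
  degree≥4 u = subst (4 ≤_) (length-filter-tabulate (adj G u) id) (deg≥4 u)
  reach : ∀ {u} → u ≢ x → WalkIn G ⊤ u x → Reach (adj G) (V ∋_) N u
  reach ux here = ⊥-elim (ux refl)
  reach {u} ux (step {w = w} e _ p) with w ≟ x
  ... | yes refl = stop (trans (sym G x u) e)
  ... | no wx    = step e (V-intro wx) (reach wx p)
  neighbour : ∃ λ u → (V ∋ u) × (u ≢ x) × (u ≢ x)
  neighbour with count>0 {p = adj G x} (≤-trans (s≤s z≤n) (degree≥4 x))
  ... | u , e = u , V-intro ux , ux , ux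
    where
    ux : u ≢ x
    ux refl = true≢false e (irrefl G x)
  -- `x` is outside `V`, so at the outset no vertex is exempt.
  start : Admissible V (adj G) N x x
  start = record
    { symA = sym G ; irrA = irrefl G
    ; paired = λ h → ⊥-elim (≢x h refl) ; s∈N = λ h → ⊥-elim (≢x h refl) ; t∈N = λ h → ⊥-elim (≢x h refl)
    ; deg≥3 = λ {u} _ _ _ → deg-∖-adj {S = full} {adj G} (degree≥4 u)
    ; deg≥4 = λ {u} _ nu → deg-∖-nonadj {S = full} {adj G} (trans (sym G u x) nu) (degree≥4 u)
    ; reach = λ {u} su → reach (≢x su) (conn u x)
    ; other = neighbour }
  answer : Solution V (adj G) N → _
  answer (mkSolution K K⊆V (mkFam b f inj cover inK ind) out) =
    tabulateᵛ K , iso b , connected , λ h → ≢x (K⊆V (member⁻¹ h)) refl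
    where
    copy : InducedIso G (tabulateᵛ K) _ _
    copy = f , (λ {i} {j} → inj {i} {j}) , (λ _ h → cover (member⁻¹ h)) , (λ i → member (inK i)) , ind
    iso : FamilyMember _ _ → _
    iso (inj₁ (ℓ , l , d)) = inj₁ (ℓ , l , _ , _ , d , copy)
    iso (inj₂ (inj₁ d))    = inj₂ (inj₁ (_ , _ , d , copy))
    iso (inj₂ (inj₂ d))    = inj₂ (inj₂ (_ , _ , d , copy))
    outside : ∀ {u} → K ∌ u → u ∈ ∁ (tabulateᵛ K)
    outside h = x∉p⇒x∈∁p λ m → true≢false (member⁻¹ m) h
    x-outside : x ∈ ∁ (tabulateᵛ K)
    x-outside = x∉p⇒x∈∁p λ m → ≢x (K⊆V (member⁻¹ m)) refl
    walk : ∀ {u} → Reach (adj G) (λ w → (V ∋ w) × (K ∌ w)) N u → WalkIn G (∁ (tabulateᵛ K)) u x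
    walk {u} (stop e)         = step (trans (sym G u x) e) x-outside here
    walk (step e (_ , kw) r) = step e (outside kw) (walk r)
    to-x : ∀ u → u ∈ ∁ (tabulateᵛ K) → WalkIn G (∁ (tabulateᵛ K)) u x
    to-x u h with u ≟ x
    ... | yes refl = here
    ... | no ux    = walk (out (V-intro ux) (¬true⇒false λ k → x∈∁p⇒x∉p h (member k)))
    connected : ConnectedOn G (∁ (tabulateᵛ K))
    connected u v hu hv = walk-append (to-x u hu) (walk-reverse hv (to-x v hv))
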